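{- Let $\Gamma=a_1\Gamma_1+a_2\Gamma_2$ be a gluing of numerical semigroups. Suppose there exists a real number $y\geq \mathrm m(\Gamma_1)$ such that $\#\operatorname{Ap}(\Gamma_1,z)\geq \mathrm m(\Gamma_1)\left\lceil\frac{z}{y}\right\rceil$ for all $z\in\mathbb{Z}$. If $a_2>a_1y$, then $$\#\operatorname{Ap}(\Gamma,z)\geq \mathrm m(\Gamma)\left\lceil \frac{z}{a_2}\right\rceil\quad\text{for all } z\in\mathbb{Z}.$$
   Context: $\mathbb N$ denotes the non-negative integers. A numerical semigroup is a set $\langle n_1,\dots,n_m\rangle:=n_1\mathbb N+\cdots+n_m\mathbb N$ with $n_i$ positive integers and $\gcd(n_1,\dots,n_m)=1$. The minimal generators of $\Gamma$ are the elements of its unique minimal generating set. The multiplicity $\mathrm m(\Gamma)$ is the smallest positive element of $\Gamma$. For $x\in\mathbb Z$, the Apéry set is $\operatorname{Ap}(\Gamma,x)=\{a\in\Gamma\mid a-x\notin\Gamma\}$. Gluing: given numerical semigroups $\Gamma_1,\Gamma_2$, $a_1\in\Gamma_2$ and $a_2\in\Gamma_1$ with $\gcd(a_1,a_2)=1$, $a_1$ not a minimal generator of $\Gamma_2$ and $a_2$ not a minimal generator of $\Gamma_1$, the numerical semigroup $a_1\Gamma_1+a_2\Gamma_2$ is called a gluing of $\Gamma_1$ and $\Gamma_2$. -}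

module Defs where

open import Data.Integer as ℤ using (ℤ; +_)
import Data.Integer.Properties as ℤ
open import Data.List using (List; []; _∷_; length; foldr)
open import Data.List.Membership.Propositional using () renaming (_∈_ to _∈ˡ_)
open import Data.List.Relation.Binary.Subset.Propositional using () renaming (_⊆_ to _⊆ˡ_)
open import Data.List.Relation.Unary.All using (All)
open import Data.List.Relation.Unary.Any using (here; there)
open import Data.List.Relation.Unary.Unique.Propositional using (Unique)
open import Data.Nat as ℕ using (ℕ; zero; suc)
import Data.Nat.Properties as ℕ
open import Data.Nat.GCD using (gcd; gcd-identityʳ)
open import Data.Product using (∃; ∃-syntax; _×_; _,_; proj₁; proj₂)
open import Data.Rational as ℚ using (ℚ; 0ℚ; 1ℚ; Positive; Negative; 1/_; _*_; _<_; _≤_; _⊓_)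
open import Data.Rational.Properties as ℚ
open import Data.Sum using (_⊎_; inj₁; inj₂)
open import Data.Unit using (tt)
open import Function using (_⇔_)
open import Level using (0ℓ)
open import Relation.Binary using (tri<; tri≈; tri>)
open import Relation.Binary.PropositionalEquality
  using (_≡_; refl; sym; trans; cong; subst; subst₂)
open import Relation.Nullary using (¬_; contradiction)
open import Relation.Unary using (Pred; _∈_; _≐_; ｛_｝) renaming (U to 𝕌)

private
  variable
    p q r : ℚ

------------------------------------------------------------------------
-- Dedekind reals

record ℝ : Set₁ where
  field
    L U        : Pred ℚ 0ℓ
    L-inhabited : ∃ L
    U-inhabited : ∃ U
    L-closed   : q < r → L r → L q
    U-closed   : q < r → U q → U r
    L-rounded  : L q → ∃[ r ] q < r × L r
    U-rounded  : U r → ∃[ q ] q < r × U q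
    disjoint   : ¬ (L q × U q)
    located    : q < r → L q ⊎ U r

  L<U : L q → U r → q < r
  L<U {q} {r} Lq Ur with <-cmp q r
  ... | tri< q<r _ _    = q<r
  ... | tri≈ _ refl _   = contradiction (Lq , Ur) disjoint
  ... | tri> _ _ r<q    = contradiction (L-closed r<q Lq , Ur) disjoint

infix 4 _≤ᴿ_ _<ᴿ_

_≤ᴿ_ : ℝ → ℝ → Set
x ≤ᴿ y = ∀ q → ℝ.L x q → ℝ.L y q

_<ᴿ_ : ℝ → ℝ → Set
x <ᴿ y = ∃[ q ] ℝ.U x q × ℝ.L y q

private
  below : ∀ q → ∃[ r ] r < q
  below q = q ℚ.- 1ℚ , subst (q ℚ.- 1ℚ <_) (+-identityʳ q) (+-monoʳ-< q (negative⁻¹ (ℚ.- 1ℚ)))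

  above : ∀ q → ∃[ r ] q < r
  above q = q ℚ.+ 1ℚ , subst (_< q ℚ.+ 1ℚ) (+-identityʳ q) (+-monoʳ-< q (positive⁻¹ 1ℚ))

  <-located : ∀ p → q < r → q < p ⊎ p < r
  <-located {q} p q<r with <-cmp q p
  ... | tri< q<p _ _  = inj₁ q<p
  ... | tri≈ _ refl _ = inj₂ q<r
  ... | tri> _ _ p<q  = inj₂ (<-trans p<q q<r)

  <⇒≱ : p < q → ¬ q ≤ p
  <⇒≱ p<q q≤p = <-irrefl refl (<-≤-trans p<q q≤p)

  <-⊓ : ∀ q r → p < q → p < r → p < q ⊓ r
  <-⊓ q r p<q p<r with ⊓-sel q r
  ... | inj₁ e = subst (_ <_) (sym e) p<q
  ... | inj₂ e = subst (_ <_) (sym e) p<r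

  ⊔-< : ∀ q r → q < p → r < p → q ℚ.⊔ r < p
  ⊔-< q r q<p r<p with ⊔-sel q r
  ... | inj₁ e = subst (_< _) (sym e) q<p
  ... | inj₂ e = subst (_< _) (sym e) r<p

  *-1/-cancel : ∀ p .{{_ : ℚ.NonZero p}} q → p * (q * 1/ p) ≡ q
  *-1/-cancel p q = trans (cong (p *_) (*-comm q (1/ p)))
    (trans (sym (*-assoc p (1/ p) q))
    (trans (cong (_* q) (*-inverseʳ p)) (*-identityˡ q)))

fromℚ : ℚ → ℝ
fromℚ p = record
  { L           = _< p
  ; U           = p <_
  ; L-inhabited = below p
  ; U-inhabited = above p
  ; L-closed    = <-trans
  ; U-closed    = λ q<r p<q → <-trans p<q q<r
  ; L-rounded   = <-dense
  ; U-rounded   = λ p<r → let q , p<q , q<r = <-dense p<r in q , q<r , p<q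
  ; disjoint    = λ (q<p , p<q) → <-asym q<p p<q
  ; located     = <-located p
  }

fromℤ : ℤ → ℝ
fromℤ i = fromℚ (i ℚ./ 1)

0ℝ : ℝ
0ℝ = fromℚ 0ℚ

-- Interval arithmetic: q is below p · x when q < p * s for every s in some
-- interval [l , u] around x; as s ↦ p * s is monotone or antitone, the
-- endpoints suffice.
infixr 7 _·_

_·_ : ℚ → ℝ → ℝ
p · x = record
  { L           = λ q → ∃[ l ] ∃[ u ] x.L l × x.U u × q < p * l × q < p * u
  ; U           = λ q → ∃[ l ] ∃[ u ] x.L l × x.U u × p * l < q × p * u < q
  ; L-inhabited = let l , Ll = x.L-inhabited
                      u , Uu = x.U-inhabited
                      q , q< = below ((p * l) ⊓ (p * u))
                  in q , l , u , Ll , Uu ,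
                     <-≤-trans q< (p⊓q≤p (p * l) (p * u)) , <-≤-trans q< (p⊓q≤q (p * l) (p * u))
  ; U-inhabited = let l , Ll = x.L-inhabited
                      u , Uu = x.U-inhabited
                      q , <q = above ((p * l) ℚ.⊔ (p * u))
                  in q , l , u , Ll , Uu ,
                     ≤-<-trans (p≤p⊔q (p * l) (p * u)) <q , ≤-<-trans (p≤q⊔p (p * l) (p * u)) <q
  ; L-closed    = λ q<r (l , u , Ll , Uu , r<pl , r<pu) →
                    l , u , Ll , Uu , <-trans q<r r<pl , <-trans q<r r<pu
  ; U-closed    = λ q<r (l , u , Ll , Uu , pl<q , pu<q) →
                    l , u , Ll , Uu , <-trans pl<q q<r , <-trans pu<q q<r
  ; L-rounded   = λ (l , u , Ll , Uu , q<pl , q<pu) →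
                    let r , q<r , r<m = <-dense (<-⊓ (p * l) (p * u) q<pl q<pu)
                    in r , q<r , l , u , Ll , Uu ,
                       <-≤-trans r<m (p⊓q≤p (p * l) (p * u)) , <-≤-trans r<m (p⊓q≤q (p * l) (p * u))
  ; U-rounded   = λ (l , u , Ll , Uu , pl<r , pu<r) →
                    let q , m<q , q<r = <-dense (⊔-< (p * l) (p * u) pl<r pu<r)
                    in q , q<r , l , u , Ll , Uu ,
                       ≤-<-trans (p≤p⊔q (p * l) (p * u)) m<q , ≤-<-trans (p≤q⊔p (p * l) (p * u)) m<q
  ; disjoint    = ·-disjoint
  ; located     = ·-located
  }
  where
  module x = ℝ x

  ·-disjoint : ¬ ((∃[ l ] ∃[ u ] x.L l × x.U u × q < p * l × q < p * u)
                × (∃[ l ] ∃[ u ] x.L l × x.U u × p * l < q × p * u < q))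
  ·-disjoint ( (l , u , Ll , Uu , q<pl , q<pu)
             , (l′ , u′ , Ll′ , Uu′ , pl′<q , pu′<q)) with ≤-total 0ℚ p
  ... | inj₁ 0≤p = <⇒≱ (<-trans pu′<q q<pl)
        (*-monoˡ-≤-nonNeg p {{ℚ.nonNegative 0≤p}} (<⇒≤ (x.L<U Ll Uu′)))
  ... | inj₂ p≤0 = <⇒≱ (<-trans pl′<q q<pu)
        (*-monoˡ-≤-nonPos p {{ℚ.nonPositive p≤0}} (<⇒≤ (x.L<U Ll′ Uu)))

  Lower Upper : ℚ → Set
  Lower q = ∃[ l ] ∃[ u ] x.L l × x.U u × q < p * l × q < p * u
  Upper q = ∃[ l ] ∃[ u ] x.L l × x.U u × p * l < q × p * u < q

  located⁺ : .{{_ : Positive p}} → q < r → Lower q ⊎ Upper r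
  located⁺ {q} {r} q<r = go (x.located (*-monoˡ-<-pos (1/ p) {{1/pos⇒pos p}} q<r))
    where
    instance
      p≢0 : ℚ.NonZero p
      p≢0 = pos⇒nonZero p

    go : x.L (q * 1/ p) ⊎ x.U (r * 1/ p) → Lower q ⊎ Upper r
    go (inj₁ Lq/p) =
      let l , q/p<l , Ll = x.L-rounded Lq/p
          u , Uu         = x.U-inhabited
          q<pl           = subst (_< p * l) (*-1/-cancel p q) (*-monoʳ-<-pos p q/p<l)
      in inj₁ (l , u , Ll , Uu , q<pl , <-trans q<pl (*-monoʳ-<-pos p (x.L<U Ll Uu)))
    go (inj₂ Ur/p) =
      let u , u<r/p , Uu = x.U-rounded Ur/p
          l , Ll         = x.L-inhabited
          pu<r           = subst (p * u <_) (*-1/-cancel p r) (*-monoʳ-<-pos p u<r/p)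
      in inj₂ (l , u , Ll , Uu , <-trans (*-monoʳ-<-pos p (x.L<U Ll Uu)) pu<r , pu<r)

  located⁻ : .{{_ : Negative p}} → q < r → Lower q ⊎ Upper r
  located⁻ {q} {r} q<r = go (x.located (*-monoˡ-<-neg (1/ p) {{1/neg⇒neg p}} q<r))
    where
    instance
      p≢0 : ℚ.NonZero p
      p≢0 = neg⇒nonZero p

    go : x.L (r * 1/ p) ⊎ x.U (q * 1/ p) → Lower q ⊎ Upper r
    go (inj₁ Lr/p) =
      let l , r/p<l , Ll = x.L-rounded Lr/p
          u , Uu         = x.U-inhabited
          pl<r           = subst (p * l <_) (*-1/-cancel p r) (*-monoʳ-<-neg p r/p<l)
      in inj₂ (l , u , Ll , Uu , pl<r , <-trans (*-monoʳ-<-neg p (x.L<U Ll Uu)) pl<r)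
    go (inj₂ Uq/p) =
      let u , u<q/p , Uu = x.U-rounded Uq/p
          l , Ll         = x.L-inhabited
          q<pu           = subst (_< p * u) (*-1/-cancel p q) (*-monoʳ-<-neg p u<q/p)
      in inj₁ (l , u , Ll , Uu , <-trans q<pu (*-monoʳ-<-neg p (x.L<U Ll Uu)) , q<pu)

  ·-located : q < r → Lower q ⊎ Upper r
  ·-located {q} {r} q<r with <-cmp p 0ℚ
  ... | tri< p<0 _ _  = located⁻ {{ℚ.negative p<0}} q<r
  ... | tri> _ _ 0<p  = located⁺ {{ℚ.positive 0<p}} q<r
  ... | tri≈ _ refl _ with x.L-inhabited | x.U-inhabited | <-located 0ℚ q<r
  ...   | l , Ll | u , Uu | inj₁ q<0 = inj₁ (l , u , Ll , Uu ,
            subst (q <_) (sym (*-zeroˡ l)) q<0 , subst (q <_) (sym (*-zeroˡ u)) q<0)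
  ...   | l , Ll | u , Uu | inj₂ 0<r = inj₂ (l , u , Ll , Uu ,
            subst (_< r) (sym (*-zeroˡ l)) 0<r , subst (_< r) (sym (*-zeroˡ u)) 0<r)

-- q < 1/x iff q * x < 1, and 1/x < q iff 1 < q * x.
reciprocal : (x : ℝ) → 0ℝ <ᴿ x → ℝ
reciprocal x (b , 0<b , Lb) = record
  { L           = λ q → ∃[ u ] x.U u × q * u < 1ℚ
  ; U           = λ q → ∃[ l ] 0ℚ < l × x.L l × 1ℚ < q * l
  ; L-inhabited = let u , Uu = x.U-inhabited
                  in 0ℚ , u , Uu , subst (_< 1ℚ) (sym (*-zeroˡ u)) (positive⁻¹ 1ℚ)
  ; U-inhabited = let q , 1/b<q = above (1ℚ * 1/ b)
                  in q , b , 0<b , Lb ,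
                     subst₂ _<_ (*-1/-cancel b 1ℚ) (*-comm b q) (*-monoʳ-<-pos b 1/b<q)
  ; L-closed    = λ q<r (u , Uu , ru<1) →
                    u , Uu , <-trans (*-monoˡ-<-pos u {{U⇒pos Uu}} q<r) ru<1
  ; U-closed    = λ q<r (l , 0<l , Ll , 1<ql) →
                    l , 0<l , Ll , <-trans 1<ql (*-monoˡ-<-pos l {{ℚ.positive 0<l}} q<r)
  ; L-rounded   = L-rounded
  ; U-rounded   = U-rounded
  ; disjoint    = λ {q} → disjoint {q}
  ; located     = located
  }
  where
  module x = ℝ x

  instance
    b⁺ : Positive b
    b⁺ = ℚ.positive 0<b
    b≢0 : ℚ.NonZero b
    b≢0 = pos⇒nonZero b

  U⇒pos : ∀ {u} → x.U u → Positive u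
  U⇒pos Uu = ℚ.positive (<-trans 0<b (x.L<U Lb Uu))

  inv : ∀ s .{{_ : Positive s}} → ℚ
  inv s = (1/ s) {{pos⇒nonZero s}}

  inv-* : ∀ s .{{_ : Positive s}} → inv s * s ≡ 1ℚ
  inv-* s = *-inverseˡ s {{pos⇒nonZero s}}

  L-rounded : (∃[ u ] x.U u × q * u < 1ℚ) →
              ∃[ r ] q < r × ∃[ u ] x.U u × r * u < 1ℚ
  L-rounded {q} (u , Uu , qu<1) =
    let instance _ = U⇒pos Uu
        instance _ = pos⇒nonNeg u
        q<1/u = *-cancelʳ-<-nonNeg u {q} {inv u} (subst (q * u <_) (sym (inv-* u)) qu<1)
        r , q<r , r<1/u = <-dense q<1/u
    in r , q<r , u , Uu , subst (r * u <_) (inv-* u) (*-monoˡ-<-pos u r<1/u)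

  U-rounded : (∃[ l ] 0ℚ < l × x.L l × 1ℚ < r * l) →
              ∃[ q ] q < r × ∃[ l ] 0ℚ < l × x.L l × 1ℚ < q * l
  U-rounded {r} (l , 0<l , Ll , 1<rl) =
    let instance _ = ℚ.positive 0<l
        instance _ = pos⇒nonNeg l
        1/l<r = *-cancelʳ-<-nonNeg l {inv l} {r} (subst (_< r * l) (sym (inv-* l)) 1<rl)
        q , 1/l<q , q<r = <-dense 1/l<r
    in q , q<r , l , 0<l , Ll , subst (_< q * l) (inv-* l) (*-monoˡ-<-pos l 1/l<q)

  disjoint : ¬ ((∃[ u ] x.U u × q * u < 1ℚ) × (∃[ l ] 0ℚ < l × x.L l × 1ℚ < q * l))
  disjoint {q} ((u , Uu , qu<1) , (l , 0<l , Ll , 1<ql)) =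
    <⇒≱ (<-trans qu<1 1<ql) (*-monoˡ-≤-nonNeg q {{ℚ.nonNegative 0≤q}} (<⇒≤ (x.L<U Ll Uu)))
    where
    0≤q : 0ℚ ≤ q
    0≤q with ≤-total 0ℚ q
    ... | inj₁ 0≤q = 0≤q
    ... | inj₂ q≤0 = contradiction
      (subst (q * l ≤_) (*-zeroˡ l)
        (*-monoʳ-≤-nonNeg l {{pos⇒nonNeg l {{ℚ.positive 0<l}}}} q≤0))
      (<⇒≱ (<-trans (positive⁻¹ 1ℚ) 1<ql))

  located : q < r → (∃[ u ] x.U u × q * u < 1ℚ) ⊎ (∃[ l ] 0ℚ < l × x.L l × 1ℚ < r * l)
  located {q} {r} q<r with <-≤-connex 0ℚ q
    where
    <-≤-connex : ∀ a c → a < c ⊎ c ≤ a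
    <-≤-connex a c with <-cmp a c
    ... | tri< a<c _ _ = inj₁ a<c
    ... | tri≈ _ e _   = inj₂ (≤-reflexive (sym e))
    ... | tri> _ _ c<a = inj₂ (<⇒≤ c<a)
  ... | inj₂ q≤0 =
    let u , Uu = x.U-inhabited
        instance _ = pos⇒nonNeg u {{U⇒pos Uu}}
    in inj₁ (u , Uu , ≤-<-trans (subst (q * u ≤_) (*-zeroˡ u) (*-monoʳ-≤-nonNeg u q≤0)) (positive⁻¹ 1ℚ))
  ... | inj₁ 0<q = helper (x.located (proj₂ (proj₂ mid)))
    where
    0<r = <-trans 0<q q<r
    instance
      q⁺ : Positive q
      q⁺ = ℚ.positive 0<q
      r⁺ : Positive r
      r⁺ = ℚ.positive 0<r
      q≢0 : ℚ.NonZero q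
      q≢0 = pos⇒nonZero q
      r≢0 : ℚ.NonZero r
      r≢0 = pos⇒nonZero r
    1/r = 1ℚ * 1/ r
    1/q = 1ℚ * 1/ q
    instance
      1/r⁺ : Positive 1/r
      1/r⁺ = subst Positive (sym (*-identityˡ (1/ r))) (1/pos⇒pos r)
      1/r₀ : ℚ.NonNegative 1/r
      1/r₀ = pos⇒nonNeg 1/r
    1/r<1/q : 1/r < 1/q
    1/r<1/q = *-cancelˡ-<-nonNeg q {{pos⇒nonNeg q}}
      (subst (q * 1/r <_) (trans (*-1/-cancel r 1ℚ) (sym (*-1/-cancel q 1ℚ)))
             (*-monoˡ-<-pos 1/r q<r))
    mid : ∃[ s ] 1/r < s × s < 1/q
    mid = <-dense 1/r<1/q
    s = proj₁ mid
    helper : x.L s ⊎ x.U 1/q →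
             (∃[ u ] x.U u × q * u < 1ℚ) ⊎ (∃[ l ] 0ℚ < l × x.L l × 1ℚ < r * l)
    helper (inj₁ Ls) = inj₂ (s , <-trans (positive⁻¹ 1/r) (proj₁ (proj₂ mid)) , Ls ,
      subst (_< r * s) (*-1/-cancel r 1ℚ) (*-monoʳ-<-pos r (proj₁ (proj₂ mid))))
    helper (inj₂ U1/q) = let u , u<1/q , Uu = x.U-rounded U1/q in
      inj₁ (u , Uu , subst (q * u <_) (*-1/-cancel q 1ℚ) (*-monoʳ-<-pos q u<1/q))

quotient : ℤ → (y : ℝ) → 0ℝ <ᴿ y → ℝ
quotient z y 0<y = (z ℚ./ 1) · reciprocal y 0<y

-- A relation rather than a function: the ceiling of a Dedekind real is
-- not computable.
IsCeiling : ℝ → ℤ → Set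
IsCeiling x k = x ≤ᴿ fromℤ k × (∀ j → x ≤ᴿ fromℤ j → k ℤ.≤ j)

------------------------------------------------------------------------
-- Numerical semigroups

infixr 7 _⊙_
infixr 6 _⊕_

_⊙_ : ℕ → Pred ℕ 0ℓ → Pred ℕ 0ℓ
(a ⊙ S) x = ∃[ s ] s ∈ S × x ≡ a ℕ.* s

_⊕_ : Pred ℕ 0ℓ → Pred ℕ 0ℓ → Pred ℕ 0ℓ
(S ⊕ T) x = ∃[ s ] ∃[ t ] s ∈ S × t ∈ T × x ≡ s ℕ.+ t

⟨_⟩ : List ℕ → Pred ℕ 0ℓ
⟨ [] ⟩     = ｛ 0 ｝
⟨ n ∷ ns ⟩ = n ⊙ 𝕌 ⊕ ⟨ ns ⟩

IsNumericalSemigroup : Pred ℕ 0ℓ → Set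
IsNumericalSemigroup S =
  ∃[ ns ] All (0 ℕ.<_) ns × foldr gcd 0 ns ≡ 1 × S ≐ ⟨ ns ⟩

IsMinimalGeneratingSet : Pred ℕ 0ℓ → List ℕ → Set
IsMinimalGeneratingSet S ns =
  ⟨ ns ⟩ ≐ S × (∀ ms → ms ⊆ˡ ns → ⟨ ms ⟩ ≐ S → ns ⊆ˡ ms)

IsMinimalGenerator : Pred ℕ 0ℓ → ℕ → Set
IsMinimalGenerator S x = ∃[ ns ] IsMinimalGeneratingSet S ns × x ∈ˡ ns

IsMultiplicity : Pred ℕ 0ℓ → ℕ → Set
IsMultiplicity S m = m ∈ S × 0 ℕ.< m × (∀ x → x ∈ S → 0 ℕ.< x → m ℕ.≤ x)

Ap : Pred ℕ 0ℓ → ℤ → Pred ℕ 0ℓ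
Ap S x a = a ∈ S × ¬ (∃[ b ] b ∈ S × + b ≡ + a ℤ.- x)

infix 4 _HasCardinality_ #_≥_

_HasCardinality_ : Pred ℕ 0ℓ → ℕ → Set
P HasCardinality n =
  ∃[ xs ] Unique xs × (∀ a → a ∈ˡ xs ⇔ a ∈ P) × length xs ≡ n

#_≥_ : Pred ℕ 0ℓ → ℤ → Set
# P ≥ k = ∃[ n ] P HasCardinality n × + n ℤ.≥ k

record IsGluing (Γ₁ Γ₂ : Pred ℕ 0ℓ) (a₁ a₂ : ℕ) : Set where
  field
    Γ₁-isNumericalSemigroup : IsNumericalSemigroup Γ₁
    Γ₂-isNumericalSemigroup : IsNumericalSemigroup Γ₂
    a₁∈Γ₂      : a₁ ∈ Γ₂
    a₂∈Γ₁      : a₂ ∈ Γ₁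
    coprime    : gcd a₁ a₂ ≡ 1
    a₁-nonminimal : ¬ IsMinimalGenerator Γ₂ a₁
    a₂-nonminimal : ¬ IsMinimalGenerator Γ₁ a₂

glue : Pred ℕ 0ℓ → Pred ℕ 0ℓ → ℕ → ℕ → Pred ℕ 0ℓ
glue Γ₁ Γ₂ a₁ a₂ = a₁ ⊙ Γ₁ ⊕ a₂ ⊙ Γ₂

multiplicity≤⇒positive : ∀ {S m} → IsMultiplicity S m → (y : ℝ) →
                         fromℤ (+ m) ≤ᴿ y → 0ℝ <ᴿ y
multiplicity≤⇒positive {m = suc m} _ y m≤y =
  let q , 0<q , q<m = <-dense (positive⁻¹ (+ suc m ℚ./ 1) {{normalize-pos (suc m) 1}})
  in q , 0<q , m≤y q q<m

private
  *-closed : ∀ ns k {x} → x ∈ ⟨ ns ⟩ → k ℕ.* x ∈ ⟨ ns ⟩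
  *-closed []       k refl = sym (ℕ.*-zeroʳ k)
  *-closed (n ∷ ns) k (_ , t , (c , _ , refl) , t∈ , refl) =
    n ℕ.* (k ℕ.* c) , k ℕ.* t , (k ℕ.* c , tt , refl) , *-closed ns k t∈ ,
    trans (ℕ.*-distribˡ-+ k (n ℕ.* c) t) (cong (ℕ._+ k ℕ.* t)
      (trans (sym (ℕ.*-assoc k n c))
      (trans (cong (ℕ._* c) (ℕ.*-comm k n)) (ℕ.*-assoc n k c))))

  1-minimal : ∀ {S} → IsNumericalSemigroup S → 1 ∈ S → IsMinimalGenerator S 1
  1-minimal {S} (ns , _ , _ , S⊆ , ⊆S) 1∈S =
    1 ∷ [] ,
    ( ( (λ {x} _ → all∈S x)
      , (λ {x} _ → x , 0 , (x , tt , sym (ℕ.*-identityˡ x)) , refl , sym (ℕ.+-identityʳ x)))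
    , minimal) ,
    here refl
    where
    all∈S : ∀ x → x ∈ S
    all∈S x = ⊆S (subst (_∈ ⟨ ns ⟩) (ℕ.*-identityʳ x) (*-closed ns x (S⊆ 1∈S)))

    minimal : ∀ ms → ms ⊆ˡ 1 ∷ [] → ⟨ ms ⟩ ≐ S → 1 ∷ [] ⊆ˡ ms
    minimal [] _ (_ , S⊆ms) _ with () ← S⊆ms 1∈S
    minimal (m ∷ ms) ms⊆ _ (here refl) with here refl ← ms⊆ (here refl) = here refl

a₂-nonZero : ∀ {Γ₁ Γ₂ a₁ a₂} → IsGluing Γ₁ Γ₂ a₁ a₂ → ℕ.NonZero a₂
a₂-nonZero {a₂ = suc _} _ = _
a₂-nonZero {a₁ = a₁} {a₂ = zero} g
  with refl ← trans (sym (gcd-identityʳ a₁)) (IsGluing.coprime g) =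
  contradiction (1-minimal Γ₂-isNumericalSemigroup a₁∈Γ₂) a₁-nonminimal
  where open IsGluing g

-- Let w i be the least element of Γ₂ congruent to i modulo a₁. Every integer is uniquely
-- a₁ u + a₂ w i with 0 ≤ i < a₁, and it lies in Γ iff u ∈ Γ₁. Writing z = a₁ ζ + a₂ ω, this
-- splits Ap(Γ, z) into copies of Ap(Γ₁, zᵢ) with zᵢ = ζ + a₂ tᵢ, where ∑ tᵢ = ω. Put
-- q = ⌈z / a₂⌉ and Nᵢ = a₁ tᵢ + q - ω. From a₂ (q - 1) < z one gets a₂ (Nᵢ - 1) < a₁ zᵢ, so
-- Nᵢ ≤ ⌈zᵢ / y⌉ whenever Nᵢ > 0, hence #Ap(Γ₁, zᵢ) ≥ m(Γ₁) Nᵢ for every i. As ∑ Nᵢ = a₁ q, the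
-- sum over i is a₁ m(Γ₁) q, and m(Γ) ≤ a₁ m(Γ₁). The ceiling of zᵢ / y exists only up to
-- double negation; since Ap(Γ₁, zᵢ) can be enumerated, its bound is a decidable statement.
module Submission where

open import Defs
open import Data.Integer
  using (ℤ; +_; -[1+_]; _+_; _*_; _-_; -_; _≤_; _<_; ∣_∣; +≤+; +<+; -≤+; _%ℕ_; _/ℕ_; Positive; positive; nonNegative)
import Data.Integer.DivMod as ℤ
open import Data.Integer.Divisibility.Signed using (divides; _∣?_)
import Data.Integer.GCD as ℤ
import Data.Integer.Properties as ℤ
open import Data.Integer.Tactic.RingSolver using (solve-∀)
open import Data.List using (List; []; _∷_; _++_; foldr; filter; map; upTo)
open import Data.List.Membership.Propositional using () renaming (_∈_ to _∈ˡ_)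
open import Data.List.Membership.Propositional.Properties
  using (∈-++⁺ˡ; ∈-++⁺ʳ; ∈-++⁻; ∈-filter⁺; ∈-filter⁻; ∈-map⁺; ∈-map⁻; ∈-upTo⁺)
open import Data.List.Membership.Propositional.Properties.WithK using (unique∧set⇒bag)
open import Data.List.Properties using (length-++; length-map)
open import Data.List.Relation.Binary.BagAndSetEquality using (∼bag⇒↭)
open import Data.List.Relation.Binary.Permutation.Propositional.Properties using (↭-length)
open import Data.List.Relation.Unary.All using (All; []; _∷_)
open import Data.List.Relation.Unary.AllPairs using ([])
import Data.List.Relation.Unary.Unique.Propositional.Properties as Unique
open import Data.Nat using (ℕ; zero; suc; NonZero; z≤n; s≤s)
import Data.Nat as ℕ
open import Data.Nat.DivMod using (_%_; m%n<n; m≡m%n+[m/n]*n)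
import Data.Nat.DivMod as ℕ
open import Data.Nat.GCD using (gcd; gcd-GCD; gcd-comm; gcd[m,n]≢0; module Bézout)
open import Data.Nat.Induction using (<-rec)
import Data.Nat.Properties as ℕ
import Data.Nat.Tactic.RingSolver as ℕSolver
open import Data.Product using (∃; ∃-syntax; _×_; _,_; proj₁; proj₂)
open import Data.Rational using (ℚ; _/_; ceiling; floor; ↥_; ↧_; ↧ₙ_; 1/_; toℚᵘ)
import Data.Rational as ℚ
import Data.Rational.Properties as ℚ
open import Data.Rational.Unnormalised using (mkℚᵘ; *≤*; *<*)
import Data.Rational.Unnormalised as ℚᵘ
import Data.Rational.Unnormalised.Properties as ℚᵘ
open import Data.Sum using (_⊎_; inj₁; inj₂; [_,_]′)
open import Data.Unit using (tt)
open import Function using (_∘_; _⇔_; mk⇔; Equivalence)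
open import Level using (0ℓ)
open import Relation.Binary.PropositionalEquality
  using (_≡_; refl; sym; trans; cong; cong₂; subst; subst₂; module ≡-Reasoning)
open import Relation.Nullary using (¬_; Dec; yes; no; ¬¬-map)
open import Relation.Nullary.Decidable using (map′; _×-dec_; decidable-stable; ¬¬-excluded-middle; ¬?)
open import Relation.Unary using (Pred; Decidable; _∈_; _⊆_; _≐_; _∪_)

private
  variable
    P Q S : Pred ℕ 0ℓ
    κ κ′ : ℤ

-- Cardinalities of finite sets of naturals

-- For duplicate-free lists, having the same members already means having them with the same
-- multiplicity, so two enumerations of one set are permutations of each other.
HasCardinality-unique : ∀ {m n} → P HasCardinality m → P HasCardinality n → m ≡ n
HasCardinality-unique (xs , xs! , xs⇔ , refl) (ys , ys! , ys⇔ , refl) =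
  ↭-length (∼bag⇒↭ (unique∧set⇒bag xs! ys! λ {a} →
    mk⇔ (from (ys⇔ a) ∘ to (xs⇔ a)) (from (xs⇔ a) ∘ to (ys⇔ a))))
  where open Equivalence

bounded⇒HasCardinality : Decidable P → ∀ b → (∀ {x} → x ∈ P → x ℕ.< b) →
                         ∃[ n ] P HasCardinality n
bounded⇒HasCardinality P? b P<b =
  _ , filter P? (upTo b) , Unique.filter⁺ P? (Unique.upTo⁺ b) ,
  (λ a → mk⇔ (proj₂ ∘ ∈-filter⁻ P? {xs = upTo b}) (λ Pa → ∈-filter⁺ P? (∈-upTo⁺ (P<b Pa)) Pa)) ,
  refl

-- Once a cardinality is known, its uniqueness turns the bound into a comparison of two integers.
-- That is decidable, so a double negation coming from the ceiling can be removed.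
#-stable : ∀ {n} → P HasCardinality n → ¬ ¬ (# P ≥ κ) → # P ≥ κ
#-stable {κ = κ} {n} card ¬¬# = n , card , decidable-stable (κ ℤ.≤? + n)
  (¬¬-map (λ (n′ , card′ , k≤n′) → subst (λ x → κ ≤ + x) (HasCardinality-unique card′ card) k≤n′) ¬¬#)

#-weaken : κ′ ≤ κ → # P ≥ κ → # P ≥ κ′
#-weaken k′≤k (n , card , k≤n) = n , card , ℤ.≤-trans k′≤k k≤n

#-nonPositive : κ ≤ + 0 → # P ≥ κ′ → # P ≥ κ
#-nonPositive k≤0 (n , card , _) = n , card , ℤ.≤-trans k≤0 (+≤+ z≤n)

#-resp-≐ : P ≐ Q → # P ≥ κ → # Q ≥ κ
#-resp-≐ (P⊆Q , Q⊆P) (n , (xs , xs! , xs⇔ , len) , k≤n) =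
  n , (xs , xs! , (λ a → mk⇔ (P⊆Q ∘ to (xs⇔ a)) (from (xs⇔ a) ∘ Q⊆P)) , len) , k≤n
  where open Equivalence

#-image : ∀ {f : ℕ → ℕ} → (∀ {x y} → f x ≡ f y → x ≡ y) →
          # P ≥ κ → # (λ y → ∃[ x ] x ∈ P × y ≡ f x) ≥ κ
#-image {P = P} {f = f} f-inj (n , (xs , xs! , xs⇔ , len) , k≤n) =
  n , (map f xs , Unique.map⁺ f-inj xs! , map⇔ , trans (length-map f xs) len) , k≤n
  where
  open Equivalence
  map⇔ : ∀ y → y ∈ˡ map f xs ⇔ (∃[ x ] x ∈ P × y ≡ f x)
  map⇔ y = mk⇔
    (λ y∈ → let x , x∈ , y≡ = ∈-map⁻ f y∈ in x , to (xs⇔ x) x∈ , y≡)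
    (λ (x , x∈ , y≡) → subst (_∈ˡ map f xs) (sym y≡) (∈-map⁺ f (from (xs⇔ x) x∈)))

#-∪ : (∀ {x} → x ∈ P → ¬ x ∈ Q) → # P ≥ κ → # Q ≥ κ′ → # (P ∪ Q) ≥ κ + κ′
#-∪ P∩Q=∅ (m , (xs , xs! , xs⇔ , refl) , k≤m) (n , (ys , ys! , ys⇔ , refl) , k′≤n) =
  m ℕ.+ n ,
  ( xs ++ ys
  , Unique.++⁺ xs! ys! (λ (x∈ , y∈) → P∩Q=∅ (to (xs⇔ _) x∈) (to (ys⇔ _) y∈))
  , (λ a → mk⇔
      ([ inj₁ ∘ to (xs⇔ a) , inj₂ ∘ to (ys⇔ a) ]′ ∘ ∈-++⁻ xs)
      [ ∈-++⁺ˡ ∘ from (xs⇔ a) , ∈-++⁺ʳ xs ∘ from (ys⇔ a) ]′)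
  , length-++ xs) ,
  ℤ.+-mono-≤ k≤m k′≤n
  where open Equivalence

∑< : ℕ → (ℕ → ℤ) → ℤ
∑< zero    f = + 0
∑< (suc n) f = ∑< n f + f n

#-⋃ : ∀ n (P : ℕ → Pred ℕ 0ℓ) {k : ℕ → ℤ} → (∀ i → # P i ≥ k i) →
      (∀ {i j x} → i ℕ.< j → j ℕ.< n → x ∈ P i → ¬ x ∈ P j) →
      # (λ x → ∃[ i ] i ℕ.< n × x ∈ P i) ≥ ∑< n k
#-⋃ zero    P #P disj = 0 , ([] , [] , (λ _ → mk⇔ (λ ()) (λ ())) , refl) , ℤ.≤-refl
#-⋃ (suc n) P #P disj = #-resp-≐ (split , merge)
  (#-∪ (λ (i , i<n , x∈) → disj i<n ℕ.≤-refl x∈)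
       (#-⋃ n P #P (λ i<j j<n → disj i<j (ℕ.m≤n⇒m≤1+n j<n))) (#P n))
  where
  split : ∀ {x} → (∃[ i ] i ℕ.< n × x ∈ P i) ⊎ x ∈ P n → ∃[ i ] i ℕ.< suc n × x ∈ P i
  split (inj₁ (i , i<n , x∈)) = i , ℕ.m≤n⇒m≤1+n i<n , x∈
  split (inj₂ x∈)             = n , ℕ.≤-refl , x∈
  merge : ∀ {x} → ∃[ i ] i ℕ.< suc n × x ∈ P i → (∃[ i ] i ℕ.< n × x ∈ P i) ⊎ x ∈ P n
  merge (i , s≤s i≤n , x∈) with ℕ.m≤n⇒m<n∨m≡n i≤n
  ... | inj₁ i<n  = inj₁ (i , i<n , x∈)
  ... | inj₂ refl = inj₂ x∈

-- Sums over an initial segment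

∑<-suc : ∀ n f → ∑< n (f ∘ suc) + f 0 ≡ ∑< n f + f n
∑<-suc zero    f = refl
∑<-suc (suc n) f = trans (swap (∑< n (f ∘ suc)) (f (suc n)) (f 0)) (cong (_+ f (suc n)) (∑<-suc n f))
  where
  swap : ∀ s x y → s + x + y ≡ s + y + x
  swap = solve-∀

-- Sliding the window of n consecutive values by one replaces `g 0` by `g n`, which is `g 0 - 1`,
-- and so lowers the sum by 1; this is repeated ω times. For Kunz coordinates it says that the tᵢ
-- add up to ω.
∑<-shift : ∀ n {g} → (∀ i → g (i ℕ.+ n) ≡ g i - + 1) →
           ∀ ω → ∑< n g ≡ ∑< n (λ i → g (ω ℕ.+ i)) + + ω
∑<-shift n         _      zero    = sym (ℤ.+-identityʳ _)
∑<-shift n {g = g} period (suc ω) = begin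
  ∑< n g                                   ≡⟨ insert (∑< n g) (g 0) ⟩
  ∑< n g + (g 0 - + 1) - g 0 + + 1         ≡⟨ cong (λ x → ∑< n g + x - g 0 + + 1) (period 0) ⟨
  ∑< n g + g n - g 0 + + 1                 ≡⟨ cong (λ x → x - g 0 + + 1) (∑<-suc n g) ⟨
  ∑< n (g ∘ suc) + g 0 - g 0 + + 1         ≡⟨ cong (λ x → x + g 0 - g 0 + + 1) (∑<-shift n (period ∘ suc) ω) ⟩
  ∑< n (λ i → g (suc ω ℕ.+ i)) + + ω + g 0 - g 0 + + 1 ≡⟨ collect (∑< n (λ i → g (suc ω ℕ.+ i))) (+ ω) (g 0) ⟩
  ∑< n (λ i → g (suc ω ℕ.+ i)) + + suc ω   ∎
  where
  open ≡-Reasoning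
  insert : ∀ s x → s ≡ s + (x - + 1) - x + + 1
  insert = solve-∀
  collect : ∀ s w x → s + w + x - x + + 1 ≡ s + (+ 1 + w)
  collect = solve-∀

-- Tailored to the summands m(Γ₁) Nᵢ, where Nᵢ = a tᵢ + (q - ω) and tᵢ is the difference of two Kunz
-- coordinates.
∑<-affine : ∀ n m a c (f h : ℕ → ℤ) →
  ∑< n (λ i → m * (a * (f i - h i) + c)) ≡ m * (a * (∑< n f - ∑< n h) + + n * c)
∑<-affine zero m a c f h = base m a c
  where
  base : ∀ m a c → + 0 ≡ m * (a * (+ 0 - + 0) + + 0 * c)
  base = solve-∀
∑<-affine (suc n) m a c f h =
  trans (cong (_+ m * (a * (f n - h n) + c)) (∑<-affine n m a c f h))
        (step m a c (∑< n f) (∑< n h) (f n) (h n) (+ n))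
  where
  step : ∀ m a c F H x y n → m * (a * (F - H) + n * c) + m * (a * (x - y) + c)
                           ≡ m * (a * (F + x - (H + y)) + (+ 1 + n) * c)
  step = solve-∀

-- Numerical semigroups

least : Decidable P → ∀ n → n ∈ P → ∃[ m ] m ∈ P × (∀ {k} → k ∈ P → m ℕ.≤ k)
least {P = P} P? = <-rec _ search
  where
  search : ∀ n → (∀ {m} → m ℕ.< n → m ∈ P → ∃[ l ] l ∈ P × (∀ {k} → k ∈ P → l ℕ.≤ k)) →
           n ∈ P → ∃[ l ] l ∈ P × (∀ {k} → k ∈ P → l ℕ.≤ k)
  search n rec n∈P with ℕ.anyUpTo? P? n
  ... | yes (m , m<n , m∈P) = rec m<n m∈P
  ... | no ∄m = n , n∈P , λ {k} k∈P → ℕ.≮⇒≥ λ k<n → ∄m (k , k<n , k∈P)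

private
  transfer : ∀ {d x y m n} → d ℕ.+ y ℕ.* n ≡ x ℕ.* m → + d ≡ + x * + m + - + y * + n
  transfer {d} {x} {y} {m} {n} eq = begin
    + d                                       ≡⟨ cancel (+ d) (+ y) (+ n) ⟩
    + d + + y * + n + - + y * + n             ≡⟨ cong (λ e → + d + e + - + y * + n) (ℤ.pos-* y n) ⟨
    + (d ℕ.+ y ℕ.* n) + - + y * + n           ≡⟨ cong (λ e → + e + - + y * + n) eq ⟩
    + (x ℕ.* m) + - + y * + n                 ≡⟨ cong (_+ - + y * + n) (ℤ.pos-* x m) ⟩
    + x * + m + - + y * + n                   ∎
    where
    open ≡-Reasoning
    cancel : ∀ d y n → d ≡ d + y * n + - y * n
    cancel = solve-∀

bézout : ∀ m n → ∃[ α ] ∃[ β ] + gcd m n ≡ α * + m + β * + n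
bézout m n with Bézout.identity (gcd-GCD m n)
... | Bézout.+- x y eq = + x , - + y , transfer {x = x} {y} {m} {n} eq
... | Bézout.-+ x y eq = - + x , + y ,
  trans (transfer {x = y} {x} {n} {m} eq) (ℤ.+-comm (+ y * + n) (- + x * + m))

⟨⟩-closed-+ : ∀ ns {x y} → x ∈ ⟨ ns ⟩ → y ∈ ⟨ ns ⟩ → x ℕ.+ y ∈ ⟨ ns ⟩
⟨⟩-closed-+ []       refl y∈ = y∈
⟨⟩-closed-+ (n ∷ ns) (_ , t , (c , _ , refl) , t∈ , refl) (_ , t′ , (c′ , _ , refl) , t′∈ , refl) =
  n ℕ.* (c ℕ.+ c′) , t ℕ.+ t′ , (c ℕ.+ c′ , tt , refl) , ⟨⟩-closed-+ ns t∈ t′∈ ,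
  regroup n c c′ t t′
  where
  regroup : ∀ n c c′ t t′ → n ℕ.* c ℕ.+ t ℕ.+ (n ℕ.* c′ ℕ.+ t′) ≡ n ℕ.* (c ℕ.+ c′) ℕ.+ (t ℕ.+ t′)
  regroup = ℕSolver.solve-∀

0∈⟨⟩ : ∀ ns → 0 ∈ ⟨ ns ⟩
0∈⟨⟩ []       = refl
0∈⟨⟩ (n ∷ ns) = n ℕ.* 0 , 0 , (0 , tt , refl) , 0∈⟨⟩ ns , sym (trans (ℕ.+-identityʳ _) (ℕ.*-zeroʳ n))

-- A positive generator occurs at most x times in a representation of x, so only finitely many
-- coefficients have to be tried before passing to the remaining generators.
_∈⟨_⟩? : ∀ x {ns} → All (0 ℕ.<_) ns → Dec (x ∈ ⟨ ns ⟩)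
x ∈⟨ [] ⟩? = 0 ℕ.≟ x
_∈⟨_⟩? x {suc n ∷ ns} (_ ∷ ns>0) =
  map′ to from (ℕ.anyUpTo? (λ c → (suc n ℕ.* c ℕ.≤? x) ×-dec ((x ℕ.∸ suc n ℕ.* c) ∈⟨ ns>0 ⟩?)) (suc x))
  where
  Split : Set
  Split = ∃[ c ] c ℕ.< suc x × suc n ℕ.* c ℕ.≤ x × (x ℕ.∸ suc n ℕ.* c) ∈ ⟨ ns ⟩

  to : Split → x ∈ ⟨ suc n ∷ ns ⟩
  to (c , _ , nc≤x , t∈) = suc n ℕ.* c , _ , (c , tt , refl) , t∈ , sym (ℕ.m+[n∸m]≡n nc≤x)

  from : x ∈ ⟨ suc n ∷ ns ⟩ → Split
  from (_ , t , (c , _ , refl) , t∈ , refl) =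
    c , s≤s (ℕ.≤-trans (ℕ.m≤n*m c (suc n)) (ℕ.m≤m+n _ t)) , ℕ.m≤m+n _ t ,
    subst (_∈ ⟨ ns ⟩) (sym (ℕ.m+n∸m≡n (suc n ℕ.* c) t)) t∈

-- Bézout coefficients of the gcd may be negative. Replacing them by their residues modulo a makes
-- them natural numbers, so the combination stays in the semigroup, and the error is a multiple of
-- a.
⟨⟩-gcd-residue : ∀ a .{{_ : NonZero a}} ns →
                 ∃[ t ] t ∈ ⟨ ns ⟩ × ∃[ j ] + t ≡ + foldr gcd 0 ns + + a * j
⟨⟩-gcd-residue a [] = 0 , refl , + 0 , sym (trans (ℤ.+-identityˡ (+ a * + 0)) (ℤ.*-zeroʳ (+ a)))
⟨⟩-gcd-residue a (n ∷ ns) with ⟨⟩-gcd-residue a ns | bézout n (foldr gcd 0 ns)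
... | t , t∈ , j , t≡ | α , β , d≡ =
  n ℕ.* α′ ℕ.+ β′ ℕ.* t ,
  (n ℕ.* α′ , β′ ℕ.* t , (α′ , tt , refl) , closed-* β′ , refl) ,
  j * + β′ - + n * (α /ℕ a) - + g * (β /ℕ a) , (begin
  + (n ℕ.* α′ ℕ.+ β′ ℕ.* t)           ≡⟨ cong₂ _+_ (ℤ.pos-* n α′) (ℤ.pos-* β′ t) ⟩
  + n * + α′ + + β′ * + t              ≡⟨ cong (λ e → + n * + α′ + + β′ * e) t≡ ⟩
  + n * + α′ + + β′ * (+ g + + a * j)  ≡⟨ rearrange (+ n) (+ α′) (+ β′) (+ g) (+ a) j (α /ℕ a) (β /ℕ a) ⟩
  (+ α′ + α /ℕ a * + a) * + n + (+ β′ + β /ℕ a * + a) * + g + + a * J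
    ≡⟨ cong₂ (λ x y → x * + n + y * + g + + a * J) (ℤ.a≡a%ℕn+[a/ℕn]*n α a) (ℤ.a≡a%ℕn+[a/ℕn]*n β a) ⟨
  α * + n + β * + g + + a * J          ≡⟨ cong (_+ + a * J) d≡ ⟨
  + gcd n g + + a * J                  ∎)
  where
  open ≡-Reasoning
  α′ = α %ℕ a
  β′ = β %ℕ a
  g  = foldr gcd 0 ns
  J  = j * + β′ - + n * (α /ℕ a) - + g * (β /ℕ a)
  closed-* : ∀ c → c ℕ.* t ∈ ⟨ ns ⟩
  closed-* zero    = 0∈⟨⟩ ns
  closed-* (suc c) = ⟨⟩-closed-+ ns t∈ (closed-* c)
  rearrange : ∀ n x y g a j p q →
    n * x + y * (g + a * j) ≡ (x + p * a) * n + (y + q * a) * g + a * (j * y - n * p - g * q)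
  rearrange = solve-∀

progression-cancel-≤ : ∀ a .{{_ : NonZero a}} s {j k} → s + + a * j ≤ s + + a * k → j ≤ k
progression-cancel-≤ (suc a) s {j} {k} le =
  ℤ.*-cancelˡ-≤-pos j k (+ suc a) (subst₂ _≤_ (cancel s (+ suc a * j)) (cancel s (+ suc a * k)) (ℤ.+-monoʳ-≤ (- s) le))
  where
  cancel : ∀ s x → - s + (s + x) ≡ x
  cancel = solve-∀

progression-cancel-< : ∀ a .{{_ : NonZero a}} s {j k} → s + + a * j < s + + a * k → j < k
progression-cancel-< a s lt = ℤ.≰⇒> λ k≤j →
  ℤ.<⇒≱ lt (ℤ.+-monoʳ-≤ s (ℤ.*-monoˡ-≤-nonNeg (+ a) k≤j))

i≤∣i∣ : ∀ i → i ≤ + ∣ i ∣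
i≤∣i∣ (+ n)    = ℤ.≤-refl
i≤∣i∣ -[1+ n ] = -≤+

module NumericalSemigroup {S : Pred ℕ 0ℓ} (isNumericalSemigroup : IsNumericalSemigroup S) where

  private
    gens : List ℕ
    gens = proj₁ isNumericalSemigroup

    S⊆⟨gens⟩ : S ⊆ ⟨ gens ⟩
    S⊆⟨gens⟩ = proj₁ (proj₂ (proj₂ (proj₂ isNumericalSemigroup)))

    ⟨gens⟩⊆S : ⟨ gens ⟩ ⊆ S
    ⟨gens⟩⊆S = proj₂ (proj₂ (proj₂ (proj₂ isNumericalSemigroup)))

  0∈ : 0 ∈ S
  0∈ = ⟨gens⟩⊆S (0∈⟨⟩ gens)

  closed-+ : ∀ {x y} → x ∈ S → y ∈ S → x ℕ.+ y ∈ S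
  closed-+ x∈ y∈ = ⟨gens⟩⊆S (⟨⟩-closed-+ gens (S⊆⟨gens⟩ x∈) (S⊆⟨gens⟩ y∈))

  closed-* : ∀ c {x} → x ∈ S → c ℕ.* x ∈ S
  closed-* zero    x∈ = 0∈
  closed-* (suc c) x∈ = closed-+ x∈ (closed-* c x∈)

  _∈? : Decidable S
  x ∈? = map′ ⟨gens⟩⊆S S⊆⟨gens⟩ (x ∈⟨ proj₁ (proj₂ isNumericalSemigroup) ⟩?)

  ∃≡1 : ∀ a .{{_ : NonZero a}} → ∃[ t ] t ∈ S × ∃[ j ] + t ≡ + 1 + + a * j
  ∃≡1 a with ⟨⟩-gcd-residue a gens
  ... | t , t∈ , j , t≡ = t , ⟨gens⟩⊆S t∈ , j ,
    trans t≡ (cong (λ d → + d + + a * j) (proj₁ (proj₂ (proj₂ isNumericalSemigroup))))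

  ∃≡ : ∀ a .{{_ : NonZero a}} i → ∃[ t ] t ∈ S × ∃[ j ] + t ≡ + i + + a * j
  ∃≡ a i with ∃≡1 a
  ... | t , t∈ , j , t≡ = i ℕ.* t , closed-* i t∈ , + i * j , (begin
    + (i ℕ.* t)            ≡⟨ ℤ.pos-* i t ⟩
    + i * + t              ≡⟨ cong (λ e → + i * e) t≡ ⟩
    + i * (+ 1 + + a * j)  ≡⟨ expand (+ i) (+ a) j ⟩
    + i + + a * (+ i * j)  ∎)
    where
    open ≡-Reasoning
    expand : ∀ i a j → i * (+ 1 + a * j) ≡ i + a * (i * j)
    expand = solve-∀

  -- The inequality s ≤ n forces k to be non-negative, so n is s plus k copies of a.
  closed-progression : ∀ {a s n} .{{_ : NonZero a}} k → a ∈ S → s ∈ S → s ℕ.≤ n →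
                       + n ≡ + s + + a * k → n ∈ S
  closed-progression {a} {s} {n} k a∈ s∈ s≤n n≡
    with progression-cancel-≤ a (+ s) {+ 0} {k}
           (subst₂ _≤_ (sym (trans (cong (λ e → + s + e) (ℤ.*-zeroʳ (+ a))) (ℤ.+-identityʳ (+ s)))) n≡ (+≤+ s≤n))
  ... | +≤+ {n = c} _ = subst (_∈ S)
    (ℤ.+-injective (trans (cong (λ e → + s + e) (trans (ℤ.pos-* c a) (ℤ.*-comm (+ c) (+ a)))) (sym n≡)))
    (closed-+ s∈ (closed-* c a∈))

  -- Take t in S with t ≡ 1 modulo a. For n with residue r modulo a, the element r t of S is
  -- congruent to n and at most a t, so every n ≥ a t is reached from it by adding copies of a.
  cofinite : ∀ {a} .{{_ : NonZero a}} → a ∈ S → ∃[ c ] ∀ {n} → c ℕ.≤ n → n ∈ S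
  cofinite {a} a∈ with ∃≡1 a
  ... | t , t∈ , j , t≡ = a ℕ.* t , λ {n} at≤n →
    closed-progression (+ (n ℕ./ a) - + (n % a) * j) a∈ (closed-* (n % a) t∈)
      (ℕ.≤-trans (ℕ.*-monoˡ-≤ t (ℕ.<⇒≤ (m%n<n n a))) at≤n) (begin
        + n                                            ≡⟨ cong +_ (m≡m%n+[m/n]*n n a) ⟩
        + (n % a) + + (n ℕ./ a ℕ.* a)                  ≡⟨ cong (λ e → + (n % a) + e) (ℤ.pos-* (n ℕ./ a) a) ⟩
        + (n % a) + + (n ℕ./ a) * + a                  ≡⟨ rearrange (+ (n % a)) (+ (n ℕ./ a)) (+ a) j ⟩
        + (n % a) * (+ 1 + + a * j) + + a * (+ (n ℕ./ a) - + (n % a) * j)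
          ≡⟨ cong (λ e → + (n % a) * e + + a * (+ (n ℕ./ a) - + (n % a) * j)) t≡ ⟨
        + (n % a) * + t + + a * (+ (n ℕ./ a) - + (n % a) * j)
          ≡⟨ cong (_+ + a * (+ (n ℕ./ a) - + (n % a) * j)) (ℤ.pos-* (n % a) t) ⟨
        + (n % a ℕ.* t) + + a * (+ (n ℕ./ a) - + (n % a) * j) ∎)
    where
    open ≡-Reasoning
    rearrange : ∀ r q a j → r + q * a ≡ r * (+ 1 + a * j) + a * (q - r * j)
    rearrange = solve-∀

  _∈Ap?_ : ∀ x z → Dec (x ∈ Ap S z)
  x ∈Ap? z = (x ∈?) ×-dec ¬? (translate? (+ x - z))
    where
    translate? : ∀ i → Dec (∃[ b ] b ∈ S × + b ≡ i)
    translate? (+ n)    = map′ (λ n∈ → n , n∈ , refl) (λ { (_ , b∈ , refl) → b∈ }) (n ∈?)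
    translate? -[1+ n ] = no λ { (_ , _ , ()) }

  -- If x ≥ c + |z|, then x - z ≥ c lies in S, where c is the threshold from `cofinite`; such an x
  -- is excluded from the Apéry set.
  Ap-finite : ∀ {a} .{{_ : NonZero a}} → a ∈ S → ∀ z → ∃[ n ] Ap S z HasCardinality n
  Ap-finite a∈ z = bounded⇒HasCardinality (_∈Ap? z) (c ℕ.+ ∣ z ∣) below
    where
    c = proj₁ (cofinite a∈)
    below : ∀ {x} → x ∈ Ap S z → x ℕ.< c ℕ.+ ∣ z ∣
    below {x} (_ , x-z∉) = ℕ.≰⇒> λ c+∣z∣≤x →
      let c≤x-z = begin
            + c                          ≡⟨ cancel (+ c) z ⟩
            + c + z - z                  ≤⟨ ℤ.+-monoˡ-≤ (- z) (ℤ.+-monoʳ-≤ (+ c) (i≤∣i∣ z)) ⟩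
            + (c ℕ.+ ∣ z ∣) - z          ≤⟨ ℤ.+-monoˡ-≤ (- z) (+≤+ c+∣z∣≤x) ⟩
            + x - z                      ∎
          b≡x-z = ℤ.0≤i⇒+∣i∣≡i (ℤ.≤-trans (+≤+ z≤n) c≤x-z)
      in x-z∉ (∣ + x - z ∣ ,
               proj₂ (cofinite a∈) (ℤ.drop‿+≤+ (subst (+ c ≤_) (sym b≡x-z) c≤x-z)) , b≡x-z)
      where
      open ℤ.≤-Reasoning
      cancel : ∀ c z → c ≡ c + z - z
      cancel = solve-∀

-- w enumerates Ap(S, a) by residue class; on 0 ≤ i < a the g i are the Kunz coordinates.
record AperyElements (S : Pred ℕ 0ℓ) (a : ℕ) : Set where
  field
    w     : ℕ → ℕ
    g     : ℕ → ℤ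
    w∈    : ∀ i → w i ∈ S
    w≡    : ∀ i → + w i ≡ + i + + a * g i
    g-min : ∀ i j {t} → t ∈ S → + t ≡ + i + + a * j → g i ≤ j

  -- The classes of i and i + a coincide, hence so do their least elements; only the quotient
  -- changes, by the one multiple of a moved into the index. Each inequality is an instance of
  -- minimality.
  g-periodic : ∀ i → g (i ℕ.+ a) ≡ g i - + 1
  g-periodic i = ℤ.≤-antisym
    (g-min (i ℕ.+ a) (g i - + 1) (w∈ i) (trans (w≡ i) (down (+ i) (+ a) (g i))))
    (subst (g i - + 1 ≤_) (cancel (g (i ℕ.+ a)))
      (ℤ.+-monoˡ-≤ (- + 1) (g-min i (g (i ℕ.+ a) + + 1) (w∈ (i ℕ.+ a))
        (trans (w≡ (i ℕ.+ a)) (up (+ i) (+ a) (g (i ℕ.+ a)))))))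
    where
    down : ∀ i a g → i + a * g ≡ i + a + a * (g - + 1)
    down = solve-∀
    up : ∀ i a g → i + a + a * g ≡ i + a * (g + + 1)
    up = solve-∀
    cancel : ∀ g → g + + 1 - + 1 ≡ g
    cancel = solve-∀

aperyElements : IsNumericalSemigroup S → ∀ a .{{_ : NonZero a}} → AperyElements S a
aperyElements {S} isNumericalSemigroup a = record
  { w     = λ i → proj₁ (min i)
  ; g     = λ i → proj₁ (proj₂ (proj₁ (proj₂ (min i))))
  ; w∈    = λ i → proj₁ (proj₁ (proj₂ (min i)))
  ; w≡    = λ i → proj₂ (proj₂ (proj₁ (proj₂ (min i))))
  ; g-min = λ i j t∈ t≡ → progression-cancel-≤ a (+ i)
      (subst₂ _≤_ (proj₂ (proj₂ (proj₁ (proj₂ (min i))))) t≡ (+≤+ (proj₂ (proj₂ (min i)) (t∈ , j , t≡))))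
  }
  where
  open NumericalSemigroup isNumericalSemigroup

  _∈Class_ : ℕ → ℕ → Set
  t ∈Class i = t ∈ S × ∃[ j ] + t ≡ + i + + a * j

  _∈Class?_ : ∀ t i → Dec (t ∈Class i)
  -- The search for j ranges over all integers, but it is just the question whether a divides t - i.
  t ∈Class? i = (t ∈?) ×-dec map′
    (λ (divides j eq) → j , solve-for (+ t) (+ i) (+ a) j eq)
    (λ (j , eq) → divides j (trans (cong (_- + i) eq) (cancel (+ i) (+ a) j)))
    (+ a ∣? (+ t - + i))
    where
    cancel : ∀ i a j → i + a * j - i ≡ j * a
    cancel = solve-∀
    split : ∀ t i → t ≡ i + (t - i)
    split = solve-∀
    solve-for : ∀ t i a j → t - i ≡ j * a → t ≡ i + a * j
    solve-for t i a j eq = trans (split t i) (cong (λ e → i + e) (trans eq (ℤ.*-comm j a)))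

  min : ∀ i → ∃[ m ] m ∈Class i × (∀ {t} → t ∈Class i → m ℕ.≤ t)
  min i = let t , t∈ = ∃≡ a i in least (_∈Class? i) t t∈

-- Rationals and reals

toℚᵘ-/1 : ∀ i → toℚᵘ (i / 1) ℚᵘ.≃ mkℚᵘ i 0
toℚᵘ-/1 i = ℚ.toℚᵘ-fromℚᵘ (mkℚᵘ i 0)

/1-mono-< : ∀ {i j} → i < j → i / 1 ℚ.< j / 1
/1-mono-< {i} {j} i<j = ℚ.toℚᵘ-cancel-<
  (ℚᵘ.<-respˡ-≃ (ℚᵘ.≃-sym (toℚᵘ-/1 i)) (ℚᵘ.<-respʳ-≃ (ℚᵘ.≃-sym (toℚᵘ-/1 j))
    (*<* (ℤ.*-monoʳ-<-pos (+ 1) i<j))))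

/1-mono-≤ : ∀ {i j} → i ≤ j → i / 1 ℚ.≤ j / 1
/1-mono-≤ {i} {j} i≤j = ℚ.toℚᵘ-cancel-≤
  (ℚᵘ.≤-respˡ-≃ (ℚᵘ.≃-sym (toℚᵘ-/1 i)) (ℚᵘ.≤-respʳ-≃ (ℚᵘ.≃-sym (toℚᵘ-/1 j))
    (*≤* (ℤ.*-monoʳ-≤-nonNeg (+ 1) i≤j))))

/1-homo-* : ∀ i j → (i * j) / 1 ≡ (i / 1) ℚ.* (j / 1)
/1-homo-* i j = ℚ.toℚᵘ-injective (begin
  toℚᵘ ((i * j) / 1)                ≈⟨ toℚᵘ-/1 (i * j) ⟩
  mkℚᵘ (i * j) 0                    ≈⟨ ℚᵘ.*-cong (toℚᵘ-/1 i) (toℚᵘ-/1 j) ⟨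
  toℚᵘ (i / 1) ℚᵘ.* toℚᵘ (j / 1)    ≈⟨ ℚ.toℚᵘ-homo-* (i / 1) (j / 1) ⟨
  toℚᵘ ((i / 1) ℚ.* (j / 1))        ∎)
  where open ℚᵘ.≃-Reasoning

-- The denominator is at least 1. This supplies an integer upper bound from which to start looking
-- for a ceiling.
p≤∣↥p∣/1 : ∀ p → p ℚ.≤ + ∣ ↥ p ∣ / 1
p≤∣↥p∣/1 p@record{} = ℚ.toℚᵘ-cancel-≤
  (ℚᵘ.≤-respʳ-≃ (ℚᵘ.≃-sym (toℚᵘ-/1 (+ ∣ ↥ p ∣))) (*≤* (begin
    ↥ p * + 1            ≡⟨ ℤ.*-identityʳ (↥ p) ⟩
    ↥ p                  ≤⟨ i≤∣i∣ (↥ p) ⟩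
    + ∣ ↥ p ∣            ≤⟨ +≤+ (ℕ.m≤m*n ∣ ↥ p ∣ (↧ₙ p)) ⟩
    + (∣ ↥ p ∣ ℕ.* ↧ₙ p) ≡⟨ ℤ.pos-* ∣ ↥ p ∣ (↧ₙ p) ⟩
    + ∣ ↥ p ∣ * ↧ p      ∎)))
  where open ℤ.≤-Reasoning

↥<[1+floor]*↧ : ∀ p → ↥ p < (+ 1 + floor p) * ↧ p
↥<[1+floor]*↧ p@record{} = subst (λ f → ↥ p < (+ 1 + f) * ↧ p)
  (sym (ℤ.div-pos-is-/ℕ (↥ p) (↧ₙ p))) (ℤ.n<s[n/ℕd]*d (↥ p) (↧ₙ p))

-- The ceiling of p is minus the floor of -p, so this is the floor inequality for -p with both sides
-- negated.
[ceiling-1]*↧<↥ : ∀ p → (ceiling p - + 1) * ↧ p < ↥ p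
[ceiling-1]*↧<↥ p@record{} = ℤ.neg-cancel-< (subst₂ _<_ (ℚ.↥-neg p) eq (↥<[1+floor]*↧ (ℚ.- p)))
  where
  neg : ∀ f d → (+ 1 + f) * d ≡ - ((- f - + 1) * d)
  neg = solve-∀
  eq : (+ 1 + floor (ℚ.- p)) * ↧ (ℚ.- p) ≡ - ((ceiling p - + 1) * ↧ p)
  eq = trans (cong (λ d → (+ 1 + floor (ℚ.- p)) * d) (ℚ.↧-neg p)) (neg (floor (ℚ.- p)) (↧ p))

-- The fraction `i / d` is stored in lowest terms. Multiplying its numerator and denominator by the
-- gcd, which is positive because d ≠ 0, recovers i and d.
d*[ceiling[i/d]-1]<i : ∀ i d .{{_ : NonZero d}} → + d * (ceiling (i / d) - + 1) < i
d*[ceiling[i/d]-1]<i i d = begin-strict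
  + d * c′               ≡⟨ cong (λ e → e * c′) (ℚ.↧-/ i d) ⟨
  ↧ (i / d) * gcdᶻ * c′  ≡⟨ swap (↧ (i / d)) gcdᶻ c′ ⟩
  c′ * ↧ (i / d) * gcdᶻ  <⟨ ℤ.*-monoʳ-<-pos gcdᶻ {{gcd⁺}} ([ceiling-1]*↧<↥ (i / d)) ⟩
  ↥ (i / d) * gcdᶻ       ≡⟨ ℚ.↥-/ i d ⟩
  i                      ∎
  where
  open ℤ.≤-Reasoning
  c′   = ceiling (i / d) - + 1
  gcdᶻ = ℤ.gcd i (+ d)
  gcd⁺ : Positive gcdᶻ
  gcd⁺ = positive (+<+ (ℕ.n≢0⇒n>0 (gcd[m,n]≢0 ∣ i ∣ d (inj₂ (ℕ.≢-nonZero⁻¹ d)))))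
  swap : ∀ x y z → x * y * z ≡ z * x * y
  swap = solve-∀

*-1/-cancelʳ : ∀ q .{{_ : ℚ.NonZero q}} r → r ℚ.* 1/ q ℚ.* q ≡ r
*-1/-cancelʳ q r = trans (ℚ.*-assoc r (1/ q) q)
  (trans (cong (r ℚ.*_) (ℚ.*-inverseˡ q)) (ℚ.*-identityʳ r))

-- Choose a rational r strictly between n and z / u, and put l = r / z. Then l u < 1 with u above y,
-- so l lies below 1 / y, while z l = r exceeds n.
quotient-> : ∀ n z {y u} (0<y : 0ℝ <ᴿ y) → ℝ.U y u → (+ n / 1) ℚ.* u ℚ.< z / 1 →
             ℝ.L (quotient z y 0<y) (+ n / 1)
quotient-> n z {y} {u} 0<y@(b , 0<b , Lb) Uu Nu<z =
  -- The product of a rational and a real tests both ends of an interval around 1 / y. As Z is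
  -- positive, the inequality at l carries over to the upper end u′.
  l , u′ , Ll , Uu′ , N<Zl , ℚ.<-trans N<Zl (ℚ.*-monoʳ-<-pos Z (ℝ.L<U 1/y {l} {u′} Ll Uu′))
  where
  1/y = reciprocal y 0<y
  N = + n / 1
  Z = z / 1
  instance
    u⁺ : ℚ.Positive u
    u⁺ = ℚ.positive (ℚ.<-trans 0<b (ℝ.L<U y Lb Uu))
    u≢0 : ℚ.NonZero u
    u≢0 = ℚ.pos⇒nonZero u
    u₀⁺ : ℚ.NonNegative u
    u₀⁺ = ℚ.pos⇒nonNeg u
    N₀⁺ : ℚ.NonNegative N
    N₀⁺ = ℚ.normalize-nonNeg n 1
    Z⁺ : ℚ.Positive Z
    Z⁺ = ℚ.positive (ℚ.≤-<-trans
      (subst (ℚ._≤ N ℚ.* u) (ℚ.*-zeroˡ u) (ℚ.*-monoʳ-≤-nonNeg u (ℚ.nonNegative⁻¹ N))) Nu<z)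
    Z≢0 : ℚ.NonZero Z
    Z≢0 = ℚ.pos⇒nonZero Z
    Z₀⁺ : ℚ.NonNegative Z
    Z₀⁺ = ℚ.pos⇒nonNeg Z

  between : ∃[ r ] N ℚ.< r × r ℚ.< Z ℚ.* 1/ u
  between = ℚ.<-dense (ℚ.*-cancelʳ-<-nonNeg u (subst (N ℚ.* u ℚ.<_) (sym (*-1/-cancelʳ u Z)) Nu<z))

  r = proj₁ between
  l = r ℚ.* 1/ Z

  Zl≡r : Z ℚ.* l ≡ r
  Zl≡r = trans (ℚ.*-comm Z l) (*-1/-cancelʳ Z r)

  N<Zl : N ℚ.< Z ℚ.* l
  N<Zl = subst (N ℚ.<_) (sym Zl≡r) (proj₁ (proj₂ between))

  ru<Z : r ℚ.* u ℚ.< Z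
  ru<Z = subst (r ℚ.* u ℚ.<_) (*-1/-cancelʳ u Z) (ℚ.*-monoˡ-<-pos u (proj₂ (proj₂ between)))

  Ll : ℝ.L 1/y l
  Ll = u , Uu , ℚ.*-cancelˡ-<-nonNeg Z (subst₂ ℚ._<_
    (trans (cong (ℚ._* u) (sym Zl≡r)) (ℚ.*-assoc Z l u)) (sym (ℚ.*-identityʳ Z)) ru<Z)

  u′  = proj₁ (ℝ.U-inhabited 1/y)
  Uu′ = proj₂ (ℝ.U-inhabited 1/y)

-- The least upper bound among the integers is found by searching upwards from N,
-- each comparison x ≤ᴿ fromℤ j being decided only up to double negation.
¬¬-ceiling : ∀ (x : ℝ) N → ¬ (x ≤ᴿ fromℤ N) → ¬ ¬ (∃[ k ] IsCeiling x k × N < k)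
¬¬-ceiling x N x≰N = search ∣ M - N ∣ λ p Lp →
  ℚ.<-≤-trans (ℝ.L<U x Lp Uu) (ℚ.≤-trans (p≤∣↥p∣/1 u) (/1-mono-≤ M≤))
  where
  u  = proj₁ (ℝ.U-inhabited x)
  Uu = proj₂ (ℝ.U-inhabited x)
  M  = + ∣ ↥ u ∣

  M≤ : M ≤ N + + ∣ M - N ∣
  M≤ = subst (_≤ N + + ∣ M - N ∣) (cancel N M) (ℤ.+-monoʳ-≤ N (i≤∣i∣ (M - N)))
    where
    cancel : ∀ n m → n + (m - n) ≡ m
    cancel = solve-∀

  below : ∀ {j d} → j < N + + suc d → j ≤ N + + d
  below {j} {d} j< = subst (j ≤_) (pred-+ N (+ d)) (ℤ.i<j⇒i≤pred[j] j<)
    where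
    pred-+ : ∀ n d → - + 1 + (n + (+ 1 + d)) ≡ n + d
    pred-+ = solve-∀

  N< : ∀ d → N < N + + suc d
  N< d = subst (_< N + + suc d) (ℤ.+-identityʳ N) (ℤ.+-monoʳ-< N (+<+ (s≤s z≤n)))

  search : ∀ d → x ≤ᴿ fromℤ (N + + d) → ¬ ¬ (∃[ k ] IsCeiling x k × N < k)
  search zero    x≤ ∄k = x≰N (subst (λ i → x ≤ᴿ fromℤ i) (ℤ.+-identityʳ N) x≤)
  search (suc d) x≤ ∄k = ¬¬-excluded-middle λ where
    (yes x≤N+d) → search d x≤N+d ∄k
    -- An integer bound j below `N + + suc d` would be at most `N + + d` and would make that a bound
    -- too, so `N + + suc d` is least.
    (no  x≰N+d) → ∄k (N + + suc d , (x≤ , λ j x≤j → ℤ.≮⇒≥ λ j<k →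
      x≰N+d λ p Lp → ℚ.<-≤-trans (x≤j p Lp) (/1-mono-≤ (below j<k))) , N< d)

-- Gluings

-- From a y < b one gets a rational u above y with a u < b. For N = n + 1 this yields a n u ≤ b n <
-- a z, hence n u < z and n < z / y, so the ceiling is at least N. For N ≤ 0 finiteness of the Apéry
-- set is enough.
ceiling-bound⇒Ap-bound : ∀ {S a b y} .{{_ : NonZero a}} .{{_ : NonZero b}} → ∀ m →
  IsNumericalSemigroup S → b ∈ S → (0<y : 0ℝ <ᴿ y) →
  (∀ z k → IsCeiling (quotient z y 0<y) k → # Ap S z ≥ + m * k) →
  (+ a / 1) · y <ᴿ fromℤ (+ b) →
  ∀ z N → + b * (N - + 1) < + a * z → # Ap S z ≥ + m * N
ceiling-bound⇒Ap-bound {S} {a} {b} {y} m isNS b∈S 0<y bound (q , (_ , u , _ , Uu , _ , au<q) , q<b) = go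
  where
  open NumericalSemigroup isNS

  finite : ∀ z → ∃[ n ] Ap S z HasCardinality n
  finite = Ap-finite b∈S

  nonPositive : ∀ z N → N ≤ + 0 → # Ap S z ≥ + m * N
  nonPositive z N N≤0 = let n , card = finite z in n , card , ℤ.≤-trans
    (subst (+ m * N ≤_) (ℤ.*-zeroʳ (+ m)) (ℤ.*-monoˡ-≤-nonNeg (+ m) N≤0)) (+≤+ z≤n)

  n*u<z : ∀ z n → + b * + n < + a * z → (+ n / 1) ℚ.* u ℚ.< z / 1
  n*u<z z n bn<az = ℚ.*-cancelˡ-<-nonNeg (+ a / 1) {{ℚ.normalize-nonNeg a 1}} (begin-strict
    (+ a / 1) ℚ.* ((+ n / 1) ℚ.* u)  ≡⟨ ℚ.*-assoc (+ a / 1) (+ n / 1) u ⟨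
    (+ a / 1) ℚ.* (+ n / 1) ℚ.* u    ≡⟨ cong (ℚ._* u) (ℚ.*-comm (+ a / 1) (+ n / 1)) ⟩
    (+ n / 1) ℚ.* (+ a / 1) ℚ.* u    ≡⟨ ℚ.*-assoc (+ n / 1) (+ a / 1) u ⟩
    -- Not strict, since n may be 0; the strictness comes from b n < a z below.
    (+ n / 1) ℚ.* ((+ a / 1) ℚ.* u)  ≤⟨ ℚ.*-monoˡ-≤-nonNeg (+ n / 1) {{ℚ.normalize-nonNeg n 1}}
                                          (ℚ.<⇒≤ (ℚ.<-trans au<q q<b)) ⟩
    (+ n / 1) ℚ.* (+ b / 1)          ≡⟨ ℚ.*-comm (+ n / 1) (+ b / 1) ⟩
    (+ b / 1) ℚ.* (+ n / 1)          ≡⟨ /1-homo-* (+ b) (+ n) ⟨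
    (+ b * + n) / 1                  <⟨ /1-mono-< bn<az ⟩
    (+ a * z) / 1                    ≡⟨ /1-homo-* (+ a) z ⟩
    (+ a / 1) ℚ.* (z / 1)            ∎)
    where open ℚ.≤-Reasoning

  go : ∀ z N → + b * (N - + 1) < + a * z → # Ap S z ≥ + m * N
  go z (+ zero)    _     = nonPositive z (+ 0) ℤ.≤-refl
  go z -[1+ n ]    _     = nonPositive z -[1+ n ] -≤+
  go z (+ (suc n)) bn<az = #-stable (proj₂ (finite z))
    (¬¬-map (λ (k , isCeiling , n<k) →
              #-weaken (ℤ.*-monoˡ-≤-nonNeg (+ m) (ℤ.i<j⇒suc[i]≤j n<k)) (bound z k isCeiling))
            -- Lower cuts are open and n lies in that of z / y, so z / y ≤ n would give n < n.
            (¬¬-ceiling (quotient z y 0<y) (+ n) λ z/y≤n →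
              ℚ.<-irrefl refl (z/y≤n (+ n / 1) (quotient-> n z {y} 0<y Uu (n*u<z z n bn<az)))))

module Gluing {Γ₁ Γ₂ : Pred ℕ 0ℓ} {a b : ℕ} .{{_ : NonZero a}} .{{_ : NonZero b}}
              (gluing : IsGluing Γ₁ Γ₂ a b) (apery : AperyElements Γ₂ a)
              (α β : ℤ) (αa+βb≡1 : α * + a + β * + b ≡ + 1) where

  open IsGluing gluing
  open NumericalSemigroup Γ₁-isNumericalSemigroup using (closed-+; closed-*)
  open AperyElements apery

  Γ : Pred ℕ 0ℓ
  Γ = glue Γ₁ Γ₂ a b

  -- Since a and b are coprime and a divides b d, it divides d; multiplying the Bézout identity by d
  -- exhibits the quotient.
  b∣a*-cancel : ∀ d e → + b * d ≡ + a * e → d ≡ + a * (α * d + β * e)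
  b∣a*-cancel d e bd≡ae = begin
    d                                 ≡⟨ ℤ.*-identityˡ d ⟨
    + 1 * d                           ≡⟨ cong (_* d) αa+βb≡1 ⟨
    (α * + a + β * + b) * d           ≡⟨ expand α (+ a) β (+ b) d ⟩
    + a * (α * d) + β * (+ b * d)     ≡⟨ cong (λ x → + a * (α * d) + β * x) bd≡ae ⟩
    + a * (α * d) + β * (+ a * e)     ≡⟨ collect α (+ a) β d e ⟩
    + a * (α * d + β * e)             ∎
    where
    open ≡-Reasoning
    expand : ∀ α a β b d → (α * a + β * b) * d ≡ a * (α * d) + β * (b * d)
    expand = solve-∀
    collect : ∀ α a β d e → a * (α * d) + β * (a * e) ≡ a * (α * d + β * e)
    collect = solve-∀

  element : ℕ → ℕ → ℕ
  element u t = a ℕ.* u ℕ.+ b ℕ.* t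

  +element : ∀ u t → + element u t ≡ + a * + u + + b * + t
  +element u t = cong₂ _+_ (ℤ.pos-* a u) (ℤ.pos-* b t)

  element-injective : ∀ t {u v} → element u t ≡ element v t → u ≡ v
  element-injective t {u} {v} eq = ℕ.*-cancelˡ-≡ u v a (ℕ.+-cancelʳ-≡ (b ℕ.* t) (a ℕ.* u) (a ℕ.* v) eq)

  element∈ : ∀ {u t} → u ∈ Γ₁ → t ∈ Γ₂ → element u t ∈ Γ
  element∈ u∈ t∈ = _ , _ , (_ , u∈ , refl) , (_ , t∈ , refl) , refl

  -- The coordinate u of x = a u + b w is determined by the Apéry element w, and
  -- x ∈ Γ forces u ∈ Γ₁: an element t = w + k a of Γ₂ trades k a b for b ∈ Γ₁.
  coordinate∈Γ₁ : ∀ {x} i u → x ∈ Γ → + x ≡ + a * u + + b * + w i → ∃[ v ] v ∈ Γ₁ × + v ≡ u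
  coordinate∈Γ₁ i u (_ , _ , (s , s∈ , refl) , (t , t∈ , refl) , refl) x≡ = go k 0≤k u≡
    where
    open ≡-Reasoning
    -- The quotient of t - w i by a, in the form that `b∣a*-cancel` produces.
    k = α * (+ t - + w i) + β * (u - + s)

    as+bt≡ : + a * + s + + b * + t ≡ + a * u + + b * + w i
    as+bt≡ = trans (sym (+element s t)) x≡

    t-w≡ak : + t - + w i ≡ + a * k
    t-w≡ak = b∣a*-cancel (+ t - + w i) (u - + s) (begin
      + b * (+ t - + w i)                                         ≡⟨ left (+ a) (+ s) (+ b) (+ t) (+ w i) ⟩
      (+ a * + s + + b * + t) - (+ a * + s + + b * + w i)         ≡⟨ cong (_- (+ a * + s + + b * + w i)) as+bt≡ ⟩
      (+ a * u + + b * + w i) - (+ a * + s + + b * + w i)         ≡⟨ right (+ a) (+ s) (+ b) u (+ w i) ⟩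
      + a * (u - + s)                                             ∎)
      where
      left : ∀ a s b t w → b * (t - w) ≡ (a * s + b * t) - (a * s + b * w)
      left = solve-∀
      right : ∀ a s b u w → (a * u + b * w) - (a * s + b * w) ≡ a * (u - s)
      right = solve-∀

    0≤k : + 0 ≤ k
    -- The element t lies in the class of i with quotient g i + k, and g i is the least such
    -- quotient.
    0≤k = subst₂ _≤_ (ℤ.+-inverseˡ (g i)) (cancel (g i) k) (ℤ.+-monoʳ-≤ (- g i) (g-min i (g i + k) t∈ (begin
      + t                            ≡⟨ split (+ t) (+ w i) ⟩
      + w i + (+ t - + w i)          ≡⟨ cong₂ _+_ (w≡ i) t-w≡ak ⟩
      + i + + a * g i + + a * k      ≡⟨ collect (+ i) (+ a) (g i) k ⟩
      + i + + a * (g i + k)          ∎)))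
      where
      cancel : ∀ g k → - g + (g + k) ≡ k
      cancel = solve-∀
      split : ∀ t w → t ≡ w + (t - w)
      split = solve-∀
      collect : ∀ i a g k → i + a * g + a * k ≡ i + a * (g + k)
      collect = solve-∀

    u≡ : u ≡ + s + + b * k
    u≡ = ℤ.*-cancelˡ-≡ (+ a) u (+ s + + b * k) (begin
      + a * u                                    ≡⟨ add (+ a * u) (+ b * + w i) ⟩
      (+ a * u + + b * + w i) - + b * + w i      ≡⟨ cong (_- + b * + w i) as+bt≡ ⟨
      (+ a * + s + + b * + t) - + b * + w i      ≡⟨ group (+ a) (+ s) (+ b) (+ t) (+ w i) ⟩
      + a * + s + + b * (+ t - + w i)            ≡⟨ cong (λ e → + a * + s + + b * e) t-w≡ak ⟩
      + a * + s + + b * (+ a * k)                ≡⟨ factor (+ a) (+ s) (+ b) k ⟩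
      + a * (+ s + + b * k)                      ∎)
      where
      add : ∀ x y → x ≡ (x + y) - y
      add = solve-∀
      group : ∀ a s b t w → (a * s + b * t) - b * w ≡ a * s + b * (t - w)
      group = solve-∀
      factor : ∀ a s b k → a * s + b * (a * k) ≡ a * (s + b * k)
      factor = solve-∀

    go : ∀ k → + 0 ≤ k → u ≡ + s + + b * k → ∃[ v ] v ∈ Γ₁ × + v ≡ u
    go (+ c) _ u≡ = s ℕ.+ c ℕ.* b , closed-+ s∈ (closed-* c a₂∈Γ₁) ,
      trans (cong (λ e → + s + e) (trans (ℤ.pos-* c b) (ℤ.*-comm (+ c) (+ b)))) (sym u≡)

  -- Splitting the Apéry set along the residues modulo a

  module Decomposition (z ζ : ℤ) (ω : ℕ) (z≡ : z ≡ + a * ζ + + b * + ω) where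

    -- This is zᵢ, with tᵢ = g i - g (ω + i). The pieces are indexed so that the i-th one uses the
    -- residue ω + i, which becomes i after z is subtracted.
    offset : ℕ → ℤ
    offset i = ζ + + b * (g i - g (ω ℕ.+ i))

    piece : ℕ → Pred ℕ 0ℓ
    piece i x = ∃[ u ] u ∈ Ap Γ₁ (offset i) × x ≡ element u (w (ω ℕ.+ i))

    -- Removing ω from w (ω + i) leaves an integer congruent to i modulo a, which differs from w i
    -- by a tᵢ. After multiplication by b, this difference is absorbed into the first coordinate as
    -- b tᵢ.
    translate : ∀ i u → + element u (w (ω ℕ.+ i)) - z ≡ + a * (+ u - offset i) + + b * + w i
    translate i u = begin
      + element u (w (ω ℕ.+ i)) - z
        ≡⟨ cong₂ _-_ (trans (+element u (w (ω ℕ.+ i))) (cong (λ e → + a * + u + + b * e) (w≡ (ω ℕ.+ i)))) z≡ ⟩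
      + a * + u + + b * (+ ω + + i + + a * g (ω ℕ.+ i)) - (+ a * ζ + + b * + ω)
        ≡⟨ rearrange (+ a) (+ u) (+ b) (+ ω) (+ i) (g (ω ℕ.+ i)) ζ (g i) ⟩
      + a * (+ u - offset i) + + b * (+ i + + a * g i)
        ≡⟨ cong (λ e → + a * (+ u - offset i) + + b * e) (w≡ i) ⟨
      + a * (+ u - offset i) + + b * + w i ∎
      where
      open ≡-Reasoning
      rearrange : ∀ a u b ω i g′ ζ g →
        a * u + b * (ω + i + a * g′) - (a * ζ + b * ω) ≡ a * (u - (ζ + b * (g - g′))) + b * (i + a * g)
      rearrange = solve-∀

    piece⊆Ap : ∀ {i x} → x ∈ piece i → x ∈ Ap Γ z
    piece⊆Ap {i} (u , (u∈ , u-offset∉) , refl) =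
      element∈ u∈ (w∈ (ω ℕ.+ i)) , λ (y , y∈ , y≡) →
        u-offset∉ (coordinate∈Γ₁ i (+ u - offset i) y∈ (trans y≡ (translate i u)))

    Ap⊆pieces : ∀ {x} → x ∈ Ap Γ z → ∃[ i ] i ℕ.< a × x ∈ piece i
    Ap⊆pieces (x∈@(_ , _ , (s , s∈ , refl) , (t , t∈ , refl) , refl) , x-z∉) =
      i , ℤ.n%ℕd<d (+ t - + ω) a , v , (v∈ , v-offset∉) , x≡element
      where
      open ≡-Reasoning
      -- Chosen so that t ≡ ω + i modulo a. Then t and w j differ by a (c - g j), which accounts for
      -- the correction to s in `U`.
      i = (+ t - + ω) %ℕ a
      c = (+ t - + ω) /ℕ a
      j = ω ℕ.+ i
      U = + s + + b * (c - g j)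

      x≡ : + element s t ≡ + a * U + + b * + w j
      x≡ = begin
        + element s t                                        ≡⟨ +element s t ⟩
        + a * + s + + b * + t                                ≡⟨ split (+ a) (+ s) (+ b) (+ t) (+ ω) ⟩
        + a * + s + + b * (+ ω + (+ t - + ω))
          ≡⟨ cong (λ e → + a * + s + + b * (+ ω + e)) (ℤ.a≡a%ℕn+[a/ℕn]*n (+ t - + ω) a) ⟩
        + a * + s + + b * (+ ω + (+ i + c * + a))            ≡⟨ rearrange (+ a) (+ s) (+ b) (+ ω) (+ i) c (g j) ⟩
        + a * U + + b * (+ ω + + i + + a * g j)              ≡⟨ cong (λ e → + a * U + + b * e) (w≡ j) ⟨
        + a * U + + b * + w j                                ∎
        where
        split : ∀ a s b t ω → a * s + b * t ≡ a * s + b * (ω + (t - ω))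
        split = solve-∀
        rearrange : ∀ a s b ω i c g →
          a * s + b * (ω + (i + c * a)) ≡ a * (s + b * (c - g)) + b * (ω + i + a * g)
        rearrange = solve-∀

      coordinate = coordinate∈Γ₁ j U x∈ x≡
      v  = proj₁ coordinate
      v∈ = proj₁ (proj₂ coordinate)

      x≡element : element s t ≡ element v (w j)
      x≡element = ℤ.+-injective (trans x≡ (trans
        (cong (λ e → + a * e + + b * + w j) (sym (proj₂ (proj₂ coordinate)))) (sym (+element v (w j)))))

      v-offset∉ : ¬ (∃[ y ] y ∈ Γ₁ × + y ≡ + v - offset i)
      v-offset∉ (y , y∈ , y≡) = x-z∉ (element y (w i) , element∈ y∈ (w∈ i) , (begin
        + element y (w i)                      ≡⟨ +element y (w i) ⟩
        + a * + y + + b * + w i                ≡⟨ cong (λ e → + a * e + + b * + w i) y≡ ⟩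
        + a * (+ v - offset i) + + b * + w i   ≡⟨ translate i v ⟨
        + element v (w j) - z                  ≡⟨ cong (λ x → + x - z) x≡element ⟨
        + element s t - z                      ∎))

    -- A common element makes b (j - i) a multiple of a, so j - i = a k by coprimality. But 0 < j -
    -- i < a would force 0 < k < 1.
    pieces-disjoint : ∀ {i j x} → i ℕ.< j → j ℕ.< a → x ∈ piece i → ¬ x ∈ piece j
    pieces-disjoint {i} {j} i<j j<a (u , _ , refl) (v , _ , eq) =
      ℤ.<⇒≱ k<1 (ℤ.i<j⇒suc[i]≤j 0<k)
      where
      open ≡-Reasoning
      gᵢ = g (ω ℕ.+ i)
      gⱼ = g (ω ℕ.+ j)
      e  = + u - + v - + b * (gⱼ - gᵢ)
      k  = α * (+ j - + i) + β * e

      at : ∀ u i → + element u (w (ω ℕ.+ i)) ≡ + a * + u + + b * (+ ω + + i + + a * g (ω ℕ.+ i))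
      at u i = trans (+element u _) (cong (λ x → + a * + u + + b * x) (w≡ (ω ℕ.+ i)))

      b[j-i]≡ae : + b * (+ j - + i) ≡ + a * e
      b[j-i]≡ae = begin
        + b * (+ j - + i)
          ≡⟨ left (+ a) (+ v) (+ b) (+ ω) (+ i) (+ j) gᵢ gⱼ ⟩
        + a * + v + + b * (+ ω + + j + + a * gⱼ) - (+ a * + v + + b * (+ ω + + i + + a * gⱼ))
          ≡⟨ cong (_- (+ a * + v + + b * (+ ω + + i + + a * gⱼ)))
               (trans (sym (at v j)) (trans (cong +_ (sym eq)) (at u i))) ⟩
        + a * + u + + b * (+ ω + + i + + a * gᵢ) - (+ a * + v + + b * (+ ω + + i + + a * gⱼ))
          ≡⟨ right (+ a) (+ u) (+ v) (+ b) (+ ω) (+ i) gᵢ gⱼ ⟩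
        + a * e ∎
        where
        left : ∀ a v b ω i j g g′ →
          b * (j - i) ≡ a * v + b * (ω + j + a * g′) - (a * v + b * (ω + i + a * g′))
        left = solve-∀
        right : ∀ a u v b ω i g g′ →
          a * u + b * (ω + i + a * g) - (a * v + b * (ω + i + a * g′)) ≡ a * (u - v - b * (g′ - g))
        right = solve-∀

      j≡i+ak : + j ≡ + i + + a * k
      j≡i+ak = trans (split (+ j) (+ i)) (cong (λ x → + i + x) (b∣a*-cancel (+ j - + i) e b[j-i]≡ae))
        where
        split : ∀ j i → j ≡ i + (j - i)
        split = solve-∀

      0<k : + 0 < k
      0<k = progression-cancel-< a (+ i) (subst₂ _<_ (base (+ i) (+ a)) j≡i+ak (+<+ i<j))
        where
        base : ∀ i a → i ≡ i + a * + 0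
        base = solve-∀

      k<1 : k < + 1
      k<1 = progression-cancel-< a (+ i) (subst₂ _<_ j≡i+ak (cong (λ x → + i + x) (sym (ℤ.*-identityʳ (+ a))))
        (+<+ (ℕ.<-≤-trans j<a (ℕ.m≤n+m a i))))

    Ap-bound : ∀ m → (∀ z N → + b * (N - + 1) < + a * z → # Ap Γ₁ z ≥ + m * N) →
               ∀ q → + b * (q - + 1) < z → # Ap Γ z ≥ + m * (+ a * q)
    Ap-bound m Ap₁-bound q b[q-1]<z = subst (# Ap Γ z ≥_) total
      (#-resp-≐ ((λ (i , _ , x∈) → piece⊆Ap {i} x∈) , Ap⊆pieces) (#-⋃ a piece piece-bound pieces-disjoint))
      where
      shift : ℕ → ℤ
      shift i = g i - g (ω ℕ.+ i)

      -- Add b (a tᵢ - ω) to both sides of b (q - 1) < z: the left side becomes b (Nᵢ - 1) and the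
      -- right side a zᵢ.
      offset-bound : ∀ i → + b * (+ a * shift i + (q - + ω) - + 1) < + a * offset i
      offset-bound i = subst₂ _<_
        (left (+ a) (+ b) (shift i) q (+ ω))
        (trans (cong (_+ + b * (+ a * shift i - + ω)) z≡) (right (+ a) (+ b) (shift i) ζ (+ ω)))
        (ℤ.+-monoˡ-< (+ b * (+ a * shift i - + ω)) b[q-1]<z)
        where
        left : ∀ a b d q ω → b * (q - + 1) + b * (a * d - ω) ≡ b * (a * d + (q - ω) - + 1)
        left = solve-∀
        right : ∀ a b d ζ ω → a * ζ + b * ω + b * (a * d - ω) ≡ a * (ζ + b * d)
        right = solve-∀

      piece-bound : ∀ i → # piece i ≥ + m * (+ a * shift i + (q - + ω))
      piece-bound i = #-image (element-injective (w (ω ℕ.+ i))) (Ap₁-bound (offset i) _ (offset-bound i))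

      -- The tᵢ contribute a ω in total and the a constant terms contribute a (q - ω), so ω cancels.
      total : ∑< a (λ i → + m * (+ a * shift i + (q - + ω))) ≡ + m * (+ a * q)
      total = begin
        ∑< a (λ i → + m * (+ a * shift i + (q - + ω)))
          ≡⟨ ∑<-affine a (+ m) (+ a) (q - + ω) g (λ i → g (ω ℕ.+ i)) ⟩
        + m * (+ a * (∑< a g - G) + + a * (q - + ω))
          ≡⟨ cong (λ s → + m * (+ a * (s - G) + + a * (q - + ω))) (∑<-shift a g-periodic ω) ⟩
        + m * (+ a * (G + + ω - G) + + a * (q - + ω))
          ≡⟨ collect (+ m) (+ a) G (+ ω) q ⟩
        + m * (+ a * q) ∎
        where
        open ≡-Reasoning
        G = ∑< a (λ i → g (ω ℕ.+ i))
        collect : ∀ m a G ω q → m * (a * (G + ω - G) + a * (q - ω)) ≡ m * (a * q)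
        collect = solve-∀

  -- Multiply the Bézout identity by z and reduce the coefficient of b modulo a, moving the quotient
  -- into ζ. This makes ω a natural number, as needed for shifting the index of `w`.
  decompose : ∀ z → ∃[ ζ ] ∃[ ω ] z ≡ + a * ζ + + b * + ω
  decompose z = z * α + + b * c , ω , (begin
    z                                                ≡⟨ ℤ.*-identityʳ z ⟨
    z * + 1                                          ≡⟨ cong (z *_) αa+βb≡1 ⟨
    z * (α * + a + β * + b)                          ≡⟨ expand z α (+ a) β (+ b) ⟩
    + a * (z * α) + + b * (z * β)
      ≡⟨ cong (λ e → + a * (z * α) + + b * e) (ℤ.a≡a%ℕn+[a/ℕn]*n (z * β) a) ⟩
    + a * (z * α) + + b * (+ ω + c * + a)            ≡⟨ collect z α (+ a) (+ b) (+ ω) c ⟩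
    + a * (z * α + + b * c) + + b * + ω              ∎)
    where
    open ≡-Reasoning
    ω = (z * β) %ℕ a
    c = (z * β) /ℕ a
    expand : ∀ z α a β b → z * (α * a + β * b) ≡ a * (z * α) + b * (z * β)
    expand = solve-∀
    collect : ∀ z α a b ω c → a * (z * α) + b * (ω + c * a) ≡ a * (z * α + b * c) + b * ω
    collect = solve-∀

-- The bound for the glued semigroup

glue-Ap-bound : ∀ {Γ₁ Γ₂ a b} .{{_ : NonZero a}} .{{_ : NonZero b}} → IsGluing Γ₁ Γ₂ a b → ∀ m →
  (∀ z N → + b * (N - + 1) < + a * z → # Ap Γ₁ z ≥ + m * N) →
  ∀ z q → + b * (q - + 1) < z → # Ap (glue Γ₁ Γ₂ a b) z ≥ + m * (+ a * q)
glue-Ap-bound {a = a} {b} gluing m Ap₁-bound z =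
  let open IsGluing gluing
      α , β , 1≡      = bézout a b
      open Gluing gluing (aperyElements Γ₂-isNumericalSemigroup a) α β (trans (sym 1≡) (cong +_ coprime))
      ζ , ω , z≡      = decompose z
  in Decomposition.Ap-bound z ζ ω z≡ m Ap₁-bound

-- By this symmetry `a₂-nonZero` also shows that a₁ is nonzero.
swap-gluing : ∀ {Γ₁ Γ₂ a₁ a₂} → IsGluing Γ₁ Γ₂ a₁ a₂ → IsGluing Γ₂ Γ₁ a₂ a₁
swap-gluing {a₁ = a₁} {a₂} gluing = record
  { Γ₁-isNumericalSemigroup = Γ₂-isNumericalSemigroup
  ; Γ₂-isNumericalSemigroup = Γ₁-isNumericalSemigroup
  ; a₁∈Γ₂                   = a₂∈Γ₁
  ; a₂∈Γ₁                   = a₁∈Γ₂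
  ; coprime                 = trans (gcd-comm a₂ a₁) coprime
  ; a₁-nonminimal           = a₂-nonminimal
  ; a₂-nonminimal           = a₁-nonminimal
  }
  where open IsGluing gluing

-- Pairing m₁ with the zero of Γ₂ puts a₁ m₁, which is positive, into the gluing.
glue-multiplicity-≤ : ∀ {Γ₁ Γ₂ a₁} a₂ {m₁ m} .{{_ : NonZero a₁}} → 0 ∈ Γ₂ →
                      IsMultiplicity Γ₁ m₁ → IsMultiplicity (glue Γ₁ Γ₂ a₁ a₂) m → m ℕ.≤ m₁ ℕ.* a₁
glue-multiplicity-≤ {a₁ = a₁} a₂ {m₁} {m} 0∈Γ₂ (m₁∈ , 0<m₁ , _) (_ , _ , m-min) =
  subst (m ℕ.≤_) (ℕ.*-comm a₁ m₁) (m-min (a₁ ℕ.* m₁)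
    (_ , _ , (m₁ , m₁∈ , refl) , (0 , 0∈Γ₂ , refl) ,
      sym (trans (cong (a₁ ℕ.* m₁ ℕ.+_) (ℕ.*-zeroʳ a₂)) (ℕ.+-identityʳ (a₁ ℕ.* m₁))))
    (ℕ.*-mono-≤ (ℕ.>-nonZero⁻¹ a₁) 0<m₁))

theorem15 : (Γ₁ Γ₂ : Pred ℕ 0ℓ) (a₁ a₂ : ℕ) (gluing : IsGluing Γ₁ Γ₂ a₁ a₂) →
    (m₁ m : ℕ) (m₁-mult : IsMultiplicity Γ₁ m₁) →
    IsMultiplicity (glue Γ₁ Γ₂ a₁ a₂) m →
    (y : ℝ) (m₁≤y : fromℤ (+ m₁) ≤ᴿ y) →
    (∀ (z k : ℤ) →
    IsCeiling (quotient z y (multiplicity≤⇒positive m₁-mult y m₁≤y)) k →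
    # Ap Γ₁ z ≥ + m₁ * k) →
    (+ a₁ / 1) · y <ᴿ fromℤ (+ a₂) →
    ∀ (z : ℤ) →
    # Ap (glue Γ₁ Γ₂ a₁ a₂) z ≥ + m * ceiling ((z / a₂) {{a₂-nonZero gluing}})
theorem15 Γ₁ Γ₂ a₁ a₂ gluing m₁ m m₁-mult m-mult y m₁≤y bound a₁y<a₂ z = scale (ℤ.≤-total (+ 0) q)
  where
  open IsGluing gluing
  instance
    a₁≢0 : NonZero a₁
    a₁≢0 = a₂-nonZero (swap-gluing gluing)
    a₂≢0 : NonZero a₂
    a₂≢0 = a₂-nonZero gluing

  q : ℤ
  q = ceiling (z / a₂)

  Ap-bound : # Ap (glue Γ₁ Γ₂ a₁ a₂) z ≥ + m₁ * (+ a₁ * q)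
  Ap-bound = glue-Ap-bound gluing m₁
    (ceiling-bound⇒Ap-bound {y = y} m₁ Γ₁-isNumericalSemigroup a₂∈Γ₁
      (multiplicity≤⇒positive m₁-mult y m₁≤y) bound a₁y<a₂)
    z q (d*[ceiling[i/d]-1]<i z a₂)

  m≤m₁a₁ : m ℕ.≤ m₁ ℕ.* a₁
  m≤m₁a₁ = glue-multiplicity-≤ a₂ (NumericalSemigroup.0∈ Γ₂-isNumericalSemigroup) m₁-mult m-mult

  -- Multiplying m ≤ m₁ a₁ by q keeps its direction only for q ≥ 0; for q ≤ 0 the required bound is
  -- at most 0, and `Ap-bound` is consulted only for a cardinality.
  scale : + 0 ≤ q ⊎ q ≤ + 0 → # Ap (glue Γ₁ Γ₂ a₁ a₂) z ≥ + m * q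
  scale (inj₁ 0≤q) = #-weaken (begin
    + m * q              ≤⟨ ℤ.*-monoʳ-≤-nonNeg q {{nonNegative 0≤q}} (+≤+ m≤m₁a₁) ⟩
    + (m₁ ℕ.* a₁) * q    ≡⟨ cong (_* q) (ℤ.pos-* m₁ a₁) ⟩
    + m₁ * + a₁ * q      ≡⟨ ℤ.*-assoc (+ m₁) (+ a₁) q ⟩
    + m₁ * (+ a₁ * q)    ∎) Ap-bound
    where open ℤ.≤-Reasoning
  scale (inj₂ q≤0) = #-nonPositive
    (subst (+ m * q ≤_) (ℤ.*-zeroʳ (+ m)) (ℤ.*-monoˡ-≤-nonNeg (+ m) q≤0)) Ap-bound
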